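{- There exists a universal constant $c\in(\frac12,1)$ such that for every (possibly partial) function $f\colon X\to\{0,1\}$ with $X\subseteq\{0,1\}^m$, every $n\ge1$, every $\ell\in\{1,2,\dots,n\}$ and every $\gamma\in[c,1)$, \[ \mathrm{R}_{\gamma^\ell}\big(\mathrm{LD}^n_\ell\circ f\big)=\Omega\big(\ell\,\mathrm{R}(f)\big), \] where the implied constant is universal.
   Context: Query model: a deterministic decision tree queries input bits adaptively and outputs the label of the leaf reached; $\mathrm{cost}$ of a leaf is its depth. A randomized algorithm is a probability distribution over deterministic decision trees. For a relation $G$ mapping each $y\in\{0,1\}^n$ to a set $G(y)$ of allowed outputs, $G\circ f$ is the computational task on inputs $x=(x^{(1)},\dots,x^{(n)})\in X^n$ where an output $z$ is correct iff $z\in G(f(x^{(1)}),\dots,f(x^{(n)}))$. For any such task $T$ on domain $Y$, $\mathrm{R}_\gamma(T)$ is the minimum over randomized algorithms that, on every input in $Y$, produce a correct output with probability at least $\gamma$, of the maximum depth of a leaf reached over all inputs and all trees in the support. $\mathrm{R}(f)=\mathrm{R}_{2/3}(f)$ for the task of computing $f$ itself. List decoding: $\mathrm{LD}^n_\ell(y)=\{S\subseteq\{0,1\}^n: |S|=2^{n-\ell},\ y\in S\}$; i.e., the algorithm must output a list of $2^{n-\ell}$ strings containing $(f(x^{(1)}),\dots,f(x^{(n)}))$.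
   Formalization: The success parameter γ is rational, and randomized algorithms are finitely supported distributions over decision trees with rational probabilities, where the statement allows real ones. -}

module Defs where

open import Data.Bool using (Bool; true; false; _∧_; if_then_else_)
import Data.Bool
open import Data.Nat as ℕ using (ℕ; zero; suc; _^_; _∸_; _≡ᵇ_)
import Data.Nat.Properties
open import Data.Integer using (+_)
open import Data.Rational using (ℚ; 0ℚ; 1ℚ; _+_; _*_; _≤_; _<_; _/_)
open import Data.Fin using (Fin)
open import Data.Vec using (Vec; []; _∷_; tabulate; foldr)
open import Data.Maybe using (Maybe; just; nothing; Is-just)
open import Data.List using (List; []; _∷_; filter; length; map; _++_)
open import Data.List.Membership.Propositional using (_∈_)
open import Data.List.Relation.Unary.All using (All)
open import Data.Product using (_×_; _,_; proj₁; proj₂; Σ; ∃)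
open import Relation.Binary.PropositionalEquality using (_≡_)
open import Relation.Nullary.Decidable using (does)

data DTree (I : Set) (O : Set) : Set where
  leaf  : O → DTree I O
  query : I → (ifFalse ifTrue : DTree I O) → DTree I O

eval : {I O : Set} → DTree I O → (I → Bool) → O
eval (leaf o)      x = o
eval (query i t u) x = if x i then eval u x else eval t x

depthOn : {I O : Set} → DTree I O → (I → Bool) → ℕ
depthOn (leaf o)      x = 0
depthOn (query i t u) x = suc (if x i then depthOn u x else depthOn t x)

record Task (I O : Set) : Set₁ where
  field
    Dom     : (I → Bool) → Set
    correct : (I → Bool) → O → Bool

-- A randomized algorithm: finitely supported distribution over
-- deterministic trees, given as a list of (probability , tree) with
-- strictly positive probabilities summing to 1.
RandAlg : Set → Set → Set
RandAlg I O = List (ℚ × DTree I O)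

totalWeight : {I O : Set} → RandAlg I O → ℚ
totalWeight []             = 0ℚ
totalWeight ((p , _) ∷ ps) = p + totalWeight ps

IsDistribution : {I O : Set} → RandAlg I O → Set
IsDistribution A = All (λ pt → 0ℚ < proj₁ pt) A × totalWeight A ≡ 1ℚ

successProb : {I O : Set} → Task I O → RandAlg I O → (I → Bool) → ℚ
successProb T []             x = 0ℚ
successProb T ((p , t) ∷ ps) x =
  (if Task.correct T x (eval t x) then p else 0ℚ) + successProb T ps x

CostAtMost : {I O : Set} → Task I O → RandAlg I O → ℕ → Set
CostAtMost T A d =
  ∀ x → Task.Dom T x → ∀ {pt} → pt ∈ A → depthOn (proj₂ pt) x ℕ.≤ d

-- There is a randomized algorithm of cost ≤ d solving T with success
-- probability ≥ γ on every input of the domain.  R_γ(T) ≤ d  iff  Solves T γ d.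
Solves : {I O : Set} → Task I O → ℚ → ℕ → Set
Solves {I} {O} T γ d = Σ (RandAlg I O) λ A →
  IsDistribution A × CostAtMost T A d ×
  (∀ x → Task.Dom T x → γ ≤ successProb T A x)

-- Partial Boolean functions f : X → {0,1}, X ⊆ {0,1}^m, encoded as
-- total maps {0,1}^m → Maybe Bool with X = { x | f x ≢ nothing }.

PartialFn : ℕ → Set
PartialFn m = (Fin m → Bool) → Maybe Bool

fTask : {m : ℕ} → PartialFn m → Task (Fin m) Bool
fTask f = record
  { Dom     = λ x → Is-just (f x)
  ; correct = λ x b → agree (f x) b }
  where
    agree : Maybe Bool → Bool → Bool
    agree (just true)  true  = true
    agree (just false) false = true
    agree _            _     = false

allBits : (n : ℕ) → List (Vec Bool n)
allBits zero    = [] ∷ []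
allBits (suc n) = map (false ∷_) (allBits n) ++ map (true ∷_) (allBits n)

card : {n : ℕ} → (Vec Bool n → Bool) → ℕ
card {n} S = length (filter (λ y → Data.Bool._≟_ (S y) true) (allBits n))

sequenceV : {n : ℕ} → Vec (Maybe Bool) n → Maybe (Vec Bool n)
sequenceV [] = just []
sequenceV (just b ∷ v) with sequenceV v
... | just w  = just (b ∷ w)
... | nothing = nothing
sequenceV (nothing ∷ v) = nothing

LDTask : {m : ℕ} → (n ℓ : ℕ) → PartialFn m → Task (Fin n × Fin m) (Vec Bool n → Bool)
LDTask {m} n ℓ f = record
  { Dom     = λ x → ∀ i → Is-just (f (λ j → x (i , j)))
  ; correct = λ x S → check (sequenceV (tabulate (λ i → f (λ j → x (i , j))))) S }
  where
    check : Maybe (Vec Bool n) → (Vec Bool n → Bool) → Bool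
    check (just y) S = S y ∧ (card S ≡ᵇ 2 ^ (n ∸ ℓ))
    check nothing  S = false

_^ℚ_ : ℚ → ℕ → ℚ
q ^ℚ zero  = 1ℚ
q ^ℚ suc k = q * (q ^ℚ k)

ℕ→ℚ : ℕ → ℚ
ℕ→ℚ k = + k / 1

twoThirds : ℚ
twoThirds = + 2 / 3

RLowerBound : {m : ℕ} → PartialFn m → ℕ → Set
RLowerBound f r = ∀ d → Solves (fTask f) twoThirds d → r ℕ.≤ d

{-# OPTIONS --safe #-}

-- For weights w on labelled inputs let P and Q be the two label masses and h(w) = 4PQ/(P + Q). For a tree T
-- on one block, pot η T w is the sum of h over the leaves plus η times the expected depth.
--
-- * If no tree of depth d has pot η T w < P + Q, then along any depth-d tree on n independent blocks the
--   product of the potentials 2(P + Q) - (minimal pot) grows by a factor at most 1 + η per query. At a leaf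
--   this product controls the second moment of the label distribution, so by Cauchy-Schwarz a list of
--   2^(n-ℓ) strings catches the labels with probability at most (3/4)^ℓ, provided (1 + η)^d ≤ (9/8)^ℓ.
-- * Hence an algorithm that succeeds with probability (4/5)^ℓ yields, for every balanced w, a tree with
--   pot η T w < P + Q. Rebalancing and iterating such trees lowers h at an expected price of O(1/η) queries;
--   Markov's inequality gives a tree of depth O(1/η) = O(d/ℓ) with error at most 1/6 under w.
-- * Multiplicative weights turn these trees into a randomized algorithm for f with success probability 2/3.

module Submission where

open import Defs
open import Algebra.Bundles using (CommutativeRing)
open import Data.Bool using (Bool; true; false; not; if_then_else_; _xor_; _∧_)
import Data.Bool
open import Data.Bool.Properties using (∧-identityʳ; ∧-zeroʳ)
open import Data.Empty using (⊥; ⊥-elim)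
open import Data.Fin using (Fin; zero; suc)
import Data.Integer as ℤ
import Data.Integer.Properties as ℤ
open import Data.List using (List; []; _∷_; map; allFin; length; _++_; filter; cartesianProduct)
import Data.List as List
open import Data.List.Membership.Propositional using (_∈_)
open import Data.List.Membership.Propositional.Properties using (∈-map⁺; ∈-allFin; ∈-cartesianProduct⁺; ∈-++⁺ˡ; ∈-++⁺ʳ)
open import Data.List.Relation.Unary.All using (All; []; _∷_)
import Data.List.Relation.Unary.All as All
import Data.List.Relation.Unary.All.Properties as All
open import Data.List.Relation.Unary.Any using (Any; here; there)
import Data.List.Relation.Unary.Any as Any
open import Data.List.Relation.Unary.Any.Properties using (lookup-index)
open import Data.Maybe using (Maybe; just; Is-just)
open import Data.Maybe.Relation.Unary.Any using (just)
open import Data.Nat as ℕ using (ℕ; zero; suc; _≡ᵇ_; _∸_)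
import Data.Nat.Coprimality as Coprime
open import Data.Nat.DivMod using (m/n*n≤m; m≡m%n+[m/n]*n; m%n<n)
import Data.Nat.Properties as ℕ
open import Data.Product using (Σ; ∃; _×_; _,_; proj₁; proj₂)
open import Data.Rational hiding (truncate)
open import Data.Rational.Properties
open import Data.Sum using (inj₁; inj₂)
open import Data.Unit using (⊤; tt)
open import Data.Vec using (Vec; []; _∷_; lookup; updateAt; tabulate; replicate)
import Data.Vec as Vec
open import Data.Vec.Properties using (lookup∘tabulate)
import Data.Vec.Relation.Unary.All as VAll
open VAll using ([]; _∷_)
open import Function using (_∘_)
open import Level using (0ℓ)
open import Relation.Binary.Bundles using (DecTotalOrder)
open import Relation.Binary.PropositionalEquality
open import Relation.Nullary
open import Relation.Nullary.Decidable using (dec⇒maybe; toWitness; ¬¬-excluded-middle; decidable-stable)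
open import Tactic.RingSolver using (solve-∀)
open import Tactic.RingSolver.Core.AlmostCommutativeRing using (AlmostCommutativeRing; fromCommutativeRing)
open import Algebra.Properties.Monoid.Mult +-0-monoid using (×-assocˡ) renaming (_×_ to _×ℚ_)
open import Algebra.Properties.Semiring.Mult (CommutativeRing.semiring +-*-commutativeRing) using (×-assoc-*; ×1-homo-*)
open import Algebra.Properties.Semiring.Sum (CommutativeRing.semiring +-*-commutativeRing) using (sum; sum-cong-≗; sum-replicate; ∑-distrib-+; *-distribˡ-sum; *-distribʳ-sum)
open import Data.List.Extrema (DecTotalOrder.totalOrder ≤-decTotalOrder) using (argmin; f[argmin]≤f[⊤]; f[argmin]≤f[xs])

-- A tree on `n` blocks may interleave them adaptively, so no single block has a query budget of its
-- own. The product of potentials copes with this: a query changes one factor, and for the others it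
-- only raises the allowed depth, which is monotone. The 2 in 2(P + Q) - (minimal pot) has two
-- roles. At depth 0 the expression is 2(P² + Q²)/(P + Q), a second moment; and since h is at most P
-- + Q, the expression is at least P + Q, so that the additive price η(P + Q) of a query is at most
-- η times the factor itself. The inequality pot < P + Q is informative only for balanced weights,
-- where h equals P + Q and the inequality means that h falls by more than the queries cost; for
-- biased weights a leaf already satisfies it. Biased weights are therefore reweighted to balance,
-- and the fall of h is compared leaf by leaf, at a loss that depends on the bias. Hence the
-- iteration stops where one label has at most 1/12 of the mass and answers the other label there.

ℚ-ring : AlmostCommutativeRing 0ℓ 0ℓ
ℚ-ring = fromCommutativeRing +-*-commutativeRing λ x → dec⇒maybe (0ℚ ≟ x)

-- Inequalities and powers over the rationals

private
  variable
    a b c d p q : ℚ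

-- Separates the reason for an inequality from its algebra: `p ≤ q` carries the content, and the
-- equation is usually left to the ring solver.
≤-by : p ≤ q → a + q ≡ b + p → a ≤ b
≤-by {p} {q} {a} {b} p≤q eq = begin
  a                ≡⟨ lemma a p ⟩
  (a + p) - p      ≤⟨ +-monoˡ-≤ (- p) (+-monoʳ-≤ a p≤q) ⟩
  (a + q) - p      ≡⟨ cong (_- p) eq ⟩
  (b + p) - p      ≡⟨ sym (lemma b p) ⟩
  b                ∎
  where
  open ≤-Reasoning
  lemma : ∀ x y → x ≡ (x + y) - y
  lemma = solve-∀ ℚ-ring

*-monoˡ : 0ℚ ≤ c → a ≤ b → c * a ≤ c * b
*-monoˡ {c} 0≤c = *-monoˡ-≤-nonNeg c ⦃ nonNegative 0≤c ⦄

*-monoʳ : 0ℚ ≤ c → a ≤ b → a * c ≤ b * c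
*-monoʳ {c} 0≤c = *-monoʳ-≤-nonNeg c ⦃ nonNegative 0≤c ⦄

*-mono : 0ℚ ≤ b → 0ℚ ≤ c → a ≤ b → c ≤ d → a * c ≤ b * d
*-mono 0≤b 0≤c a≤b c≤d = ≤-trans (*-monoʳ 0≤c a≤b) (*-monoˡ 0≤b c≤d)

+-nonneg : 0ℚ ≤ a → 0ℚ ≤ b → 0ℚ ≤ a + b
+-nonneg 0≤a 0≤b = ≤-trans (≤-reflexive (sym (+-identityˡ 0ℚ))) (+-mono-≤ 0≤a 0≤b)

*-nonneg : 0ℚ ≤ a → 0ℚ ≤ b → 0ℚ ≤ a * b
*-nonneg {a} 0≤a 0≤b = ≤-trans (≤-reflexive (sym (*-zeroʳ a))) (*-monoˡ 0≤a 0≤b)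

*-pos : 0ℚ < a → 0ℚ < b → 0ℚ < a * b
*-pos {a} {b} 0<a 0<b = positive⁻¹ (a * b) ⦃ pos*pos⇒pos a ⦃ positive 0<a ⦄ b ⦃ positive 0<b ⦄ ⦄

+-pos : 0ℚ < a → 0ℚ ≤ b → 0ℚ < a + b
+-pos {a} {b} 0<a 0≤b = subst (_< a + b) (+-identityˡ 0ℚ) (+-mono-<-≤ 0<a 0≤b)

*-cancel-≤ : 0ℚ < c → c * a ≤ c * b → a ≤ b
*-cancel-≤ {c} 0<c = *-cancelˡ-≤-pos c ⦃ positive 0<c ⦄

≤-sum⇐ : 0ℚ ≤ b → a ≤ a + b
≤-sum⇐ {b} {a} 0≤b = ≤-by 0≤b (sym (+-identityʳ (a + b)))

square-nonneg : ∀ a → 0ℚ ≤ a * a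
square-nonneg a with ≤-total 0ℚ a
... | inj₁ 0≤a = *-nonneg 0≤a 0≤a
... | inj₂ a≤0 = subst (0ℚ ≤_) (lemma a) (*-nonneg 0≤-a 0≤-a)
  where
  0≤-a : 0ℚ ≤ - a
  0≤-a = neg-antimono-≤ a≤0
  lemma : ∀ x → (- x) * (- x) ≡ x * x
  lemma = solve-∀ ℚ-ring

^ℚ-nonneg : 0ℚ ≤ a → ∀ n → 0ℚ ≤ a ^ℚ n
^ℚ-nonneg 0≤a zero    = nonNegative⁻¹ 1ℚ
^ℚ-nonneg 0≤a (suc n) = *-nonneg 0≤a (^ℚ-nonneg 0≤a n)

^ℚ-pos : 0ℚ < a → ∀ n → 0ℚ < a ^ℚ n
^ℚ-pos 0<a zero    = positive⁻¹ 1ℚ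
^ℚ-pos 0<a (suc n) = *-pos 0<a (^ℚ-pos 0<a n)

^ℚ-monoˡ : 0ℚ ≤ a → a ≤ b → ∀ n → a ^ℚ n ≤ b ^ℚ n
^ℚ-monoˡ 0≤a a≤b zero    = ≤-refl
^ℚ-monoˡ 0≤a a≤b (suc n) =
  *-mono (≤-trans 0≤a a≤b) (^ℚ-nonneg 0≤a n) a≤b (^ℚ-monoˡ 0≤a a≤b n)

^ℚ-+ : ∀ a m n → a ^ℚ (m ℕ.+ n) ≡ a ^ℚ m * a ^ℚ n
^ℚ-+ a zero    n = sym (*-identityˡ _)
^ℚ-+ a (suc m) n = trans (cong (a *_) (^ℚ-+ a m n)) (sym (*-assoc a _ _))

^ℚ-distrib-* : ∀ a b n → (a * b) ^ℚ n ≡ a ^ℚ n * b ^ℚ n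
^ℚ-distrib-* a b zero    = refl
^ℚ-distrib-* a b (suc n) = trans (cong (a * b *_) (^ℚ-distrib-* a b n)) (lemma a b (a ^ℚ n) (b ^ℚ n))
  where
  lemma : ∀ a b x y → a * b * (x * y) ≡ a * x * (b * y)
  lemma = solve-∀ ℚ-ring

^ℚ-* : ∀ a m n → a ^ℚ (m ℕ.* n) ≡ (a ^ℚ n) ^ℚ m
^ℚ-* a zero    n = refl
^ℚ-* a (suc m) n = trans (^ℚ-+ a n (m ℕ.* n)) (cong (a ^ℚ n *_) (^ℚ-* a m n))

1≤^ℚ : 1ℚ ≤ a → ∀ n → 1ℚ ≤ a ^ℚ n
1≤^ℚ 1≤a zero    = ≤-refl
1≤^ℚ 1≤a (suc n) = *-mono (≤-trans (nonNegative⁻¹ 1ℚ) 1≤a) (nonNegative⁻¹ 1ℚ) 1≤a (1≤^ℚ 1≤a n)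

^ℚ-monoʳ : ∀ {m n} → 1ℚ ≤ a → m ℕ.≤ n → a ^ℚ m ≤ a ^ℚ n
^ℚ-monoʳ {n = n} 1≤a ℕ.z≤n   = 1≤^ℚ 1≤a n
^ℚ-monoʳ 1≤a (ℕ.s≤s m≤n) =
  *-monoˡ (≤-trans (nonNegative⁻¹ 1ℚ) 1≤a) (^ℚ-monoʳ 1≤a m≤n)

^ℚ-<-monoˡ : 0ℚ < a → a < b → ∀ n → 1 ℕ.≤ n → a ^ℚ n < b ^ℚ n
^ℚ-<-monoˡ {a} {b} 0<a a<b (suc n) _ = <-≤-trans
  (*-monoˡ-<-pos (a ^ℚ n) ⦃ positive (^ℚ-pos 0<a n) ⦄ a<b)
  (*-monoˡ (<⇒≤ (<-trans 0<a a<b)) (^ℚ-monoˡ (<⇒≤ 0<a) (<⇒≤ a<b) n))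

-- The function `h`, twice the harmonic mean of the label masses

2ℚ 4ℚ : ℚ
2ℚ = ℤ.+ 2 / 1
4ℚ = ℤ.+ 4 / 1

inv : ℚ → ℚ
inv x with x ≟ 0ℚ
... | yes _   = 0ℚ
... | no  x≢0 = 1/_ x ⦃ ≢-nonZero x≢0 ⦄

*-inv : 0ℚ < a → a * inv a ≡ 1ℚ
*-inv {a} 0<a with a ≟ 0ℚ
... | yes a≡0 = contradiction (sym a≡0) (<⇒≢ 0<a)
... | no  a≢0 = *-inverseʳ a ⦃ ≢-nonZero a≢0 ⦄

inv-pos : 0ℚ < a → 0ℚ < inv a
inv-pos {a} 0<a with a ≟ 0ℚ
... | yes a≡0 = contradiction (sym a≡0) (<⇒≢ 0<a)
... | no  a≢0 = positive⁻¹ (1/_ a ⦃ ≢-nonZero a≢0 ⦄) ⦃ 1/pos⇒pos a ⦃ positive 0<a ⦄ ⦄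

-- For label masses p and q this is (p + q)(1 - β²), where β = (p - q)/(p + q) is the bias; it is 0 when p + q = 0.
h : ℚ → ℚ → ℚ
h p q = 4ℚ * (p * q) * inv (p + q)

≡0⊎pos : 0ℚ ≤ a → (a ≡ 0ℚ → b ≤ c) → (0ℚ < a → b ≤ c) → b ≤ c
≡0⊎pos {a} 0≤a z s with a ≤? 0ℚ
... | yes a≤0 = z (≤-antisym a≤0 0≤a)
... | no  a≰0 = s (≰⇒> a≰0)

+≡0⇒ˡ : 0ℚ ≤ p → 0ℚ ≤ q → p + q ≡ 0ℚ → p ≡ 0ℚ
+≡0⇒ˡ {p} 0≤p 0≤q eq = ≤-antisym (subst (p ≤_) eq (≤-sum⇐ 0≤q)) 0≤p

+≡0⇒ʳ : 0ℚ ≤ p → 0ℚ ≤ q → p + q ≡ 0ℚ → q ≡ 0ℚ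
+≡0⇒ʳ {p} {q} 0≤p 0≤q eq = +≡0⇒ˡ 0≤q 0≤p (trans (+-comm q p) eq)

h-* : ∀ p q → 0ℚ < p + q → (p + q) * h p q ≡ 4ℚ * (p * q)
h-* p q pos = trans (lemma (4ℚ * (p * q)) (p + q) (inv (p + q)))
  (trans (cong (4ℚ * (p * q) *_) (*-inv pos)) (*-identityʳ _))
  where
  lemma : ∀ x s i → s * (x * i) ≡ x * (s * i)
  lemma = solve-∀ ℚ-ring

h-0 : ∀ p q → p + q ≡ 0ℚ → h p q ≡ 0ℚ
h-0 p q eq = trans (cong (λ s → 4ℚ * (p * q) * inv s) eq) (*-zeroʳ (4ℚ * (p * q)))

h-*-nonneg : 0ℚ ≤ p → 0ℚ ≤ q → (p + q) * h p q ≡ 4ℚ * (p * q)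
h-*-nonneg {p} {q} 0≤p 0≤q with p + q ≤? 0ℚ
... | no  ≰0 = h-* p q (≰⇒> ≰0)
... | yes ≤0 = trans (cong (_* h p q) p+q≡0) (trans (*-zeroˡ (h p q))
  (sym (trans (cong (λ z → 4ℚ * (z * q)) (+≡0⇒ˡ 0≤p 0≤q p+q≡0)) (lemma q))))
  where
  p+q≡0 : p + q ≡ 0ℚ
  p+q≡0 = ≤-antisym ≤0 (+-nonneg 0≤p 0≤q)
  lemma : ∀ q → 4ℚ * (0ℚ * q) ≡ 0ℚ
  lemma = solve-∀ ℚ-ring

h-nonneg : 0ℚ ≤ p → 0ℚ ≤ q → 0ℚ ≤ h p q
h-nonneg {p} {q} 0≤p 0≤q = ≡0⊎pos (+-nonneg 0≤p 0≤q) (λ eq → ≤-reflexive (sym (h-0 p q eq)))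
  λ pos → *-cancel-≤ pos (subst₂ _≤_ (sym (*-zeroʳ (p + q))) (sym (h-* p q pos))
    (*-nonneg (nonNegative⁻¹ 4ℚ) (*-nonneg 0≤p 0≤q)))

h≤+ : 0ℚ ≤ p → 0ℚ ≤ q → h p q ≤ p + q
h≤+ {p} {q} 0≤p 0≤q = ≡0⊎pos (+-nonneg 0≤p 0≤q)
  (λ eq → ≤-reflexive (trans (h-0 p q eq) (sym eq)))
  λ pos → *-cancel-≤ pos (≤-trans (≤-reflexive (h-* p q pos))
    (≤-by (square-nonneg (p - q)) (lemma p q)))
  where
  lemma : ∀ p q → 4ℚ * (p * q) + (p - q) * (p - q) ≡ (p + q) * (p + q) + 0ℚ
  lemma = solve-∀ ℚ-ring

h-balanced : 0ℚ ≤ a → a + a ≤ h a a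
h-balanced {a} 0≤a = ≡0⊎pos (+-nonneg 0≤a 0≤a)
  (λ eq → ≤-reflexive (trans eq (sym (h-0 a a eq))))
  λ pos → *-cancel-≤ pos (≤-reflexive (trans (lemma a) (sym (h-* a a pos))))
  where
  lemma : ∀ a → (a + a) * (a + a) ≡ 4ℚ * (a * a)
  lemma = solve-∀ ℚ-ring

-- With D = (βu - αv)²: 4(β²u + α²v) - (α + β)² h u v = 4D/(u + v) and βu + αv - h (βu) (αv) = D/(βu + αv).
h-tilt : ∀ {α β μ u v} → 0ℚ < α → 0ℚ < β → 0ℚ ≤ μ → μ ≤ α → μ ≤ β → 0ℚ ≤ u → 0ℚ ≤ v →
  (α + β) * (α + β) * h u v + 4ℚ * μ * (β * u + α * v)
    ≤ 4ℚ * (β * β * u + α * α * v) + 4ℚ * μ * h (β * u) (α * v)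
h-tilt {α} {β} {μ} {u} {v} 0<α 0<β 0≤μ μ≤α μ≤β 0≤u 0≤v = ≡0⊎pos (+-nonneg 0≤u 0≤v) degenerate generic
  where
  0≤β = <⇒≤ 0<β
  0≤α = <⇒≤ 0<α
  B = β * u + α * v
  D = (β * u - α * v) * (β * u - α * v)
  Y = B - h (β * u) (α * v)
  X = 4ℚ * (β * β * u + α * α * v) - (α + β) * (α + β) * h u v
  Goal : ℚ → ℚ → Set
  Goal u v = (α + β) * (α + β) * h u v + 4ℚ * μ * (β * u + α * v)
    ≤ 4ℚ * (β * β * u + α * α * v) + 4ℚ * μ * h (β * u) (α * v)
  degenerate : u + v ≡ 0ℚ → Goal u v
  degenerate eq = subst₂ Goal (sym (+≡0⇒ˡ 0≤u 0≤v eq)) (sym (+≡0⇒ʳ 0≤u 0≤v eq)) (≤-reflexive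
    (trans (cong (λ x → (α + β) * (α + β) * x + 4ℚ * μ * (β * 0ℚ + α * 0ℚ)) (h-0 0ℚ 0ℚ refl))
      (trans (lemma α β μ)
        (cong (λ y → 4ℚ * (β * β * 0ℚ + α * α * 0ℚ) + 4ℚ * μ * y)
          (sym (h-0 (β * 0ℚ) (α * 0ℚ) (cong₂ _+_ (*-zeroʳ β) (*-zeroʳ α))))))))
    where
    lemma : ∀ α β μ → (α + β) * (α + β) * 0ℚ + 4ℚ * μ * (β * 0ℚ + α * 0ℚ)
      ≡ 4ℚ * (β * β * 0ℚ + α * α * 0ℚ) + 4ℚ * μ * 0ℚ
    lemma = solve-∀ ℚ-ring
  generic : 0ℚ < u + v → Goal u v
  generic 0<A = ≤-by claim (lemma ((α + β) * (α + β) * h u v) (4ℚ * μ) B (4ℚ * (β * β * u + α * α * v)) (h (β * u) (α * v)))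
    where
    lemma : ∀ s m B t k → s + m * B + (t - s) ≡ t + m * k + m * (B - k)
    lemma = solve-∀ ℚ-ring
    μA≤B : μ * (u + v) ≤ B
    μA≤B = ≤-trans (≤-reflexive (*-distribˡ-+ μ u v)) (+-mono-≤ (*-monoʳ 0≤u μ≤β) (*-monoʳ 0≤v μ≤α))
    0<B : 0ℚ < B
    0<B with 0ℚ <? u
    ... | yes 0<u = +-pos (*-pos 0<β 0<u) (*-nonneg 0≤α 0≤v)
    ... | no 0≮u = subst (0ℚ <_) (+-comm (α * v) (β * u)) (+-pos (*-pos 0<α 0<v) (*-nonneg 0≤β 0≤u))
      where
      0<v : 0ℚ < v
      0<v = subst (0ℚ <_) (trans (cong (_+ v) (≤-antisym (≮⇒≥ 0≮u) 0≤u)) (+-identityˡ v)) 0<A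
    0≤Y : 0ℚ ≤ Y
    0≤Y = ≤-by (h≤+ (*-nonneg 0≤β 0≤u) (*-nonneg 0≤α 0≤v)) (lemma′ B (h (β * u) (α * v)))
      where
      lemma′ : ∀ b k → 0ℚ + b ≡ b - k + k
      lemma′ = solve-∀ ℚ-ring
    YB : B * Y ≡ D
    YB = trans (l1 B (h (β * u) (α * v))) (trans (cong (λ z → B * B - z) (h-* (β * u) (α * v) 0<B)) (l2 (β * u) (α * v)))
      where
      l1 : ∀ b k → b * (b - k) ≡ b * b - b * k
      l1 = solve-∀ ℚ-ring
      l2 : ∀ x y → (x + y) * (x + y) - 4ℚ * (x * y) ≡ (x - y) * (x - y)
      l2 = solve-∀ ℚ-ring
    XA : (u + v) * X ≡ 4ℚ * D
    XA = trans (l1 (u + v) (4ℚ * (β * β * u + α * α * v)) ((α + β) * (α + β)) (h u v))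
      (trans (cong (λ z → (u + v) * (4ℚ * (β * β * u + α * α * v)) - (α + β) * (α + β) * z) (h-* u v 0<A))
        (l2 α β u v))
      where
      l1 : ∀ a t s k → a * (t - s * k) ≡ a * t - s * (a * k)
      l1 = solve-∀ ℚ-ring
      l2 : ∀ α β u v → (u + v) * (4ℚ * (β * β * u + α * α * v)) - (α + β) * (α + β) * (4ℚ * (u * v))
        ≡ 4ℚ * ((β * u - α * v) * (β * u - α * v))
      l2 = solve-∀ ℚ-ring
    -- `X` and `Y` are the same square `D` over different denominators, so only `μ * (u + v) ≤ B` is
    -- left to use.
    claim : 4ℚ * μ * Y ≤ X
    claim = *-cancel-≤ 0<A (begin
      (u + v) * (4ℚ * μ * Y)    ≡⟨ l1 (u + v) μ Y ⟩
      4ℚ * (μ * (u + v) * Y)    ≤⟨ *-monoˡ (nonNegative⁻¹ 4ℚ) (*-monoʳ 0≤Y μA≤B) ⟩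
      4ℚ * (B * Y)              ≡⟨ cong (4ℚ *_) YB ⟩
      4ℚ * D                    ≡⟨ sym XA ⟩
      (u + v) * X               ∎)
      where
      open ≤-Reasoning
      l1 : ∀ a m y → a * (4ℚ * m * y) ≡ 4ℚ * (m * a * y)
      l1 = solve-∀ ℚ-ring

-- Finite sums and weights

sum-nonneg : ∀ {n} {w : Fin n → ℚ} → (∀ k → 0ℚ ≤ w k) → 0ℚ ≤ sum w
sum-nonneg {zero}  0≤w = ≤-refl
sum-nonneg {suc n} 0≤w = +-nonneg (0≤w zero) (sum-nonneg (0≤w ∘ suc))

sum-mono : ∀ {n} {v w : Fin n → ℚ} → (∀ k → v k ≤ w k) → sum v ≤ sum w
sum-mono {zero}  v≤w = ≤-refl
sum-mono {suc n} v≤w = +-mono-≤ (v≤w zero) (sum-mono (v≤w ∘ suc))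

term≤sum : ∀ {n} {w : Fin n → ℚ} → (∀ k → 0ℚ ≤ w k) → ∀ k → w k ≤ sum w
term≤sum {suc n} 0≤w zero    = ≤-sum⇐ (sum-nonneg (0≤w ∘ suc))
term≤sum {suc n} {w} 0≤w (suc k) = ≤-trans (term≤sum (0≤w ∘ suc) k)
  (≤-trans (≤-sum⇐ (0≤w zero)) (≤-reflexive (+-comm (sum (w ∘ suc)) (w zero))))

infix 7 _when_
_when_ : ℚ → Bool → ℚ
x when b = if b then x else 0ℚ

when-nonneg : ∀ {x} b → 0ℚ ≤ x → 0ℚ ≤ x when b
when-nonneg true  0≤x = 0≤x
when-nonneg false 0≤x = ≤-refl

when≤ : ∀ {x} b → 0ℚ ≤ x → x when b ≤ x
when≤ true  0≤x = ≤-refl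
when≤ false 0≤x = 0≤x

module _ {K : ℕ} where

  Weights : Set
  Weights = Fin K → ℚ

  NonNeg : Weights → Set
  NonNeg w = ∀ k → 0ℚ ≤ w k

  -- A branch zeroes out weights instead of conditioning on its event. Masses then add up over
  -- branches, and a branch of mass 0 needs no division.
  on : (Fin K → Bool) → Weights → Weights
  on c w k = w k when c k

  on-nonneg : ∀ c {w} → NonNeg w → NonNeg (on c w)
  on-nonneg c 0≤w k = when-nonneg (c k) (0≤w k)

  mass : (Fin K → Bool) → Weights → ℚ
  mass a w = sum (on a w)

  mass-nonneg : ∀ a {w} → NonNeg w → 0ℚ ≤ mass a w
  mass-nonneg a 0≤w = sum-nonneg (on-nonneg a 0≤w)

  mass≤sum : ∀ a {w} → NonNeg w → mass a w ≤ sum w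
  mass≤sum a 0≤w = sum-mono (λ k → when≤ (a k) (0≤w k))

  mass-cong : ∀ {a b} w → (∀ k → a k ≡ b k) → mass a w ≡ mass b w
  mass-cong w a≗b = sum-cong-≗ (λ k → cong (w k when_) (a≗b k))

  mass-if : ∀ c a b w →
    mass (λ k → if c k then a k else b k) w ≡ mass b (on (not ∘ c) w) + mass a (on c w)
  mass-if c a b w = trans (sum-cong-≗ pointwise) (∑-distrib-+ (on b (on (not ∘ c) w)) (on a (on c w)))
    where
    0-when : ∀ b → 0ℚ when b ≡ 0ℚ
    0-when true  = refl
    0-when false = refl
    pointwise : ∀ k → w k when (if c k then a k else b k)
      ≡ (w k when not (c k)) when b k + (w k when c k) when a k
    pointwise k with c k
    ... | true  = sym (trans (cong (_+ (w k when a k)) (0-when (b k))) (+-identityˡ _))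
    ... | false = sym (trans (cong (λ z → (w k when b k) + z) (0-when (a k))) (+-identityʳ _))

  mass-split : ∀ c a w → mass a w ≡ mass a (on (not ∘ c) w) + mass a (on c w)
  mass-split c a w = trans (mass-cong w (λ k → sym (if-same (c k) (a k)))) (mass-if c a a w)
    where
    if-same : ∀ b (x : Bool) → (if b then x else x) ≡ x
    if-same true  x = refl
    if-same false x = refl

  sum-split : ∀ c w → sum w ≡ sum (on (not ∘ c) w) + sum (on c w)
  sum-split c w = mass-split c (λ _ → true) w

-- Truncated decision trees

-- Serves two purposes: the cost of an algorithm is bounded only on the domain of its task, whereas
-- inductions on depth need a bound on the whole tree; and Markov's inequality has to cut long
-- paths.
truncate : ∀ {I O : Set} → ℕ → O → DTree I O → DTree I O
truncate n       o (leaf x)      = leaf x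
truncate zero    o (query i t u) = leaf o
truncate (suc n) o (query i t u) = query i (truncate n o t) (truncate n o u)

depthOn-truncate : ∀ {I O : Set} n (o : O) (t : DTree I O) x → depthOn (truncate n o t) x ℕ.≤ n
depthOn-truncate n       o (leaf _)      x = ℕ.z≤n
depthOn-truncate zero    o (query i t u) x = ℕ.z≤n
depthOn-truncate (suc n) o (query i t u) x with x i
... | true  = ℕ.s≤s (depthOn-truncate n o u x)
... | false = ℕ.s≤s (depthOn-truncate n o t x)

eval-truncate : ∀ {I O : Set} n (o : O) (t : DTree I O) x → depthOn t x ℕ.≤ n →
  eval (truncate n o t) x ≡ eval t x
eval-truncate n       o (leaf _)      x le = refl
eval-truncate (suc n) o (query i t u) x (ℕ.s≤s le) with x i
... | true  = eval-truncate n o u x le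
... | false = eval-truncate n o t x le

-- One block: potentials and tilted weights

module Block {K m : ℕ} (X : Fin K → Fin m → Bool) (Y : Fin K → Bool) where

  lo hi : Fin m → Weights {K} → Weights {K}
  lo j = on (λ k → not (X k j))
  hi j = on (λ k → X k j)

  lo-nonneg : ∀ j {w} → NonNeg w → NonNeg (lo j w)
  lo-nonneg j = on-nonneg (λ k → not (X k j))

  hi-nonneg : ∀ j {w} → NonNeg w → NonNeg (hi j w)
  hi-nonneg j = on-nonneg (λ k → X k j)

  P Q hw : Weights {K} → ℚ
  P = mass Y
  Q = mass (not ∘ Y)
  hw w = h (P w) (Q w)

  sum≡P+Q : ∀ w → sum w ≡ P w + Q w
  sum≡P+Q w = trans (sum-split Y w) (+-comm (Q w) (P w))

  P-split : ∀ j w → P w ≡ P (lo j w) + P (hi j w)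
  P-split j = mass-split (λ k → X k j) Y

  Q-split : ∀ j w → Q w ≡ Q (lo j w) + Q (hi j w)
  Q-split j = mass-split (λ k → X k j) (not ∘ Y)

  P-nonneg : ∀ {w} → NonNeg w → 0ℚ ≤ P w
  P-nonneg = mass-nonneg Y

  Q-nonneg : ∀ {w} → NonNeg w → 0ℚ ≤ Q w
  Q-nonneg = mass-nonneg (not ∘ Y)

  hw≤sum : ∀ {w} → NonNeg w → hw w ≤ sum w
  hw≤sum {w} 0≤w = ≤-trans (h≤+ (P-nonneg 0≤w) (Q-nonneg 0≤w)) (≤-reflexive (sym (sum≡P+Q w)))

  pot : {O : Set} → ℚ → DTree (Fin m) O → Weights → ℚ
  pot ζ (leaf _)      w = hw w
  pot ζ (query j t u) w = ζ * sum w + (pot ζ t (lo j w) + pot ζ u (hi j w))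

  pot-monoˡ : ∀ {O : Set} {ζ ξ} (T : DTree (Fin m) O) {w} → NonNeg w → ζ ≤ ξ → pot ζ T w ≤ pot ξ T w
  pot-monoˡ (leaf _)      0≤w ζ≤ξ = ≤-refl
  pot-monoˡ (query j t u) 0≤w ζ≤ξ = +-mono-≤ (*-monoʳ (sum-nonneg 0≤w) ζ≤ξ)
    (+-mono-≤ (pot-monoˡ t (lo-nonneg j 0≤w) ζ≤ξ) (pot-monoˡ u (hi-nonneg j 0≤w) ζ≤ξ))

  -- The potential of tilted weights in terms of the original ones. The factors `α` and `β` stay
  -- those of the root while `w` shrinks, so it can be compared with `pot` leaf by leaf.
  tiltedPot : {O : Set} → (α β ζ : ℚ) → DTree (Fin m) O → Weights → ℚ
  tiltedPot α β ζ (leaf _)      w = h (β * P w) (α * Q w)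
  tiltedPot α β ζ (query j t u) w =
    ζ * (β * P w + α * Q w) + (tiltedPot α β ζ t (lo j w) + tiltedPot α β ζ u (hi j w))

  tilt : (α β : ℚ) → Weights → Weights
  tilt α β w k = (if Y k then β else α) * w k

  tilt-nonneg : ∀ {α β w} → 0ℚ ≤ α → 0ℚ ≤ β → NonNeg w → NonNeg (tilt α β w)
  tilt-nonneg 0≤α 0≤β 0≤w k with Y k
  ... | true  = *-nonneg 0≤β (0≤w k)
  ... | false = *-nonneg 0≤α (0≤w k)

  module _ {α β : ℚ} where

    -- Restricting to a branch and tilting commute only pointwise; for this reason `v` is any family
    -- that agrees pointwise with a tilt.
    P-tilt : ∀ {v w} → (∀ k → v k ≡ tilt α β w k) → P v ≡ β * P w
    P-tilt {v} {w} v≗ = trans (sum-cong-≗ pointwise) (sym (*-distribˡ-sum β (on Y w)))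
      where
      pointwise : ∀ k → v k when Y k ≡ β * (w k when Y k)
      pointwise k with Y k | v≗ k
      ... | true  | eq = eq
      ... | false | eq = sym (*-zeroʳ β)

    Q-tilt : ∀ {v w} → (∀ k → v k ≡ tilt α β w k) → Q v ≡ α * Q w
    Q-tilt {v} {w} v≗ = trans (sum-cong-≗ pointwise) (sym (*-distribˡ-sum α (on (not ∘ Y) w)))
      where
      pointwise : ∀ k → v k when not (Y k) ≡ α * (w k when not (Y k))
      pointwise k with Y k | v≗ k
      ... | true  | eq = sym (*-zeroʳ α)
      ... | false | eq = eq

    on-tilt : ∀ c {v w} → (∀ k → v k ≡ tilt α β w k) → ∀ k → on c v k ≡ tilt α β (on c w) k
    on-tilt c v≗ k with c k
    ... | true  = v≗ k
    ... | false = sym (*-zeroʳ (if Y k then β else α))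

    pot-tilt : ∀ {O : Set} ζ (T : DTree (Fin m) O) {v w} → (∀ k → v k ≡ tilt α β w k) →
      pot ζ T v ≡ tiltedPot α β ζ T w
    pot-tilt ζ (leaf _)      v≗ = cong₂ h (P-tilt v≗) (Q-tilt v≗)
    pot-tilt ζ (query j t u) {v} v≗ = cong₂ (λ x y → ζ * x + y)
      (trans (sum≡P+Q v) (cong₂ _+_ (P-tilt v≗) (Q-tilt v≗)))
      (cong₂ _+_ (pot-tilt ζ t (on-tilt (λ k → not (X k j)) v≗)) (pot-tilt ζ u (on-tilt (λ k → X k j) v≗)))

    module _ {μ η ζ : ℚ} (0<α : 0ℚ < α) (0<β : 0ℚ < β) (0≤μ : 0ℚ ≤ μ) (0≤η : 0ℚ ≤ η)
             (μ≤α : μ ≤ α) (μ≤β : μ ≤ β) (ζ≤ : (α + β) * (α + β) * ζ ≤ 4ℚ * (μ * μ) * η) where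

      -- `h-tilt` summed over the leaves. A query adds `(α + β) * (α + β) * ζ * sum w` on the left
      -- and `4ℚ * μ * η * (β * P w + α * Q w)` on the right; the latter is at least
      -- `4ℚ * (μ * μ) * η * sum w`, which is where the hypothesis on `ζ` comes from.
      tiltedPot-bound : ∀ {O : Set} (T : DTree (Fin m) O) {w} → NonNeg w →
        (α + β) * (α + β) * pot ζ T w + 4ℚ * μ * (β * P w + α * Q w)
          ≤ 4ℚ * (β * β * P w + α * α * Q w) + 4ℚ * μ * tiltedPot α β η T w
      tiltedPot-bound (leaf _) 0≤w = h-tilt 0<α 0<β 0≤μ μ≤α μ≤β (P-nonneg 0≤w) (Q-nonneg 0≤w)
      tiltedPot-bound (query j t u) {w} 0≤w = subst₂ _≤_
        (trans (lemmaˡ ((α + β) * (α + β)) (4ℚ * μ) ζ (sum w) α β (P (lo j w)) (P (hi j w)) (Q (lo j w)) (Q (hi j w))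
                  (pot ζ t (lo j w)) (pot ζ u (hi j w)))
               (cong₂ (λ p q → (α + β) * (α + β) * pot ζ (query j t u) w + 4ℚ * μ * (β * p + α * q))
                  (sym (P-split j w)) (sym (Q-split j w))))
        (trans (lemmaʳ (4ℚ * μ) η (β * P w + α * Q w) α β (P (lo j w)) (P (hi j w)) (Q (lo j w)) (Q (hi j w))
                  (tiltedPot α β η t (lo j w)) (tiltedPot α β η u (hi j w)))
               (cong₂ (λ p q → 4ℚ * (β * β * p + α * α * q) + 4ℚ * μ * tiltedPot α β η (query j t u) w)
                  (sym (P-split j w)) (sym (Q-split j w))))
        (+-mono-≤ (+-mono-≤ (tiltedPot-bound t (lo-nonneg j 0≤w)) (tiltedPot-bound u (hi-nonneg j 0≤w))) queryCost)
        where
        lemmaˡ : ∀ s m z W α β p₀ p₁ q₀ q₁ a b →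
          s * a + m * (β * p₀ + α * q₀) + (s * b + m * (β * p₁ + α * q₁)) + s * z * W
            ≡ s * (z * W + (a + b)) + m * (β * (p₀ + p₁) + α * (q₀ + q₁))
        lemmaˡ = solve-∀ ℚ-ring
        lemmaʳ : ∀ m e W α β p₀ p₁ q₀ q₁ a b →
          4ℚ * (β * β * p₀ + α * α * q₀) + m * a + (4ℚ * (β * β * p₁ + α * α * q₁) + m * b) + m * e * W
            ≡ 4ℚ * (β * β * (p₀ + p₁) + α * α * (q₀ + q₁)) + m * (e * W + (a + b))
        lemmaʳ = solve-∀ ℚ-ring
        0≤4μη : 0ℚ ≤ 4ℚ * μ * η
        0≤4μη = *-nonneg (*-nonneg (nonNegative⁻¹ 4ℚ) 0≤μ) 0≤η
        queryCost : (α + β) * (α + β) * ζ * sum w ≤ 4ℚ * μ * η * (β * P w + α * Q w)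
        queryCost = begin
          (α + β) * (α + β) * ζ * sum w      ≤⟨ *-monoʳ (sum-nonneg 0≤w) ζ≤ ⟩
          4ℚ * (μ * μ) * η * sum w           ≡⟨ cong (4ℚ * (μ * μ) * η *_) (sum≡P+Q w) ⟩
          4ℚ * (μ * μ) * η * (P w + Q w)     ≡⟨ lemma μ η (P w) (Q w) ⟩
          4ℚ * μ * η * (μ * P w + μ * Q w)   ≤⟨ *-monoˡ 0≤4μη (+-mono-≤ (*-monoʳ (P-nonneg 0≤w) μ≤β) (*-monoʳ (Q-nonneg 0≤w) μ≤α)) ⟩
          4ℚ * μ * η * (β * P w + α * Q w)   ∎
          where
          open ≤-Reasoning
          lemma : ∀ μ η p q → 4ℚ * (μ * μ) * η * (p + q) ≡ 4ℚ * μ * η * (μ * p + μ * q)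
          lemma = solve-∀ ℚ-ring

  -- tilt (P w) (Q w) w is balanced: both of its label masses are P w * Q w.
  untilt : ∀ {O : Set} {μ η ζ} (T : DTree (Fin m) O) {w} → NonNeg w → 0ℚ < P w → 0ℚ < Q w → 0ℚ ≤ μ → 0ℚ ≤ η →
    μ ≤ P w → μ ≤ Q w → (P w + Q w) * (P w + Q w) * ζ ≤ 4ℚ * (μ * μ) * η →
    pot η T (tilt (P w) (Q w) w) ≤ sum (tilt (P w) (Q w) w) → pot ζ T w ≤ hw w
  untilt {μ = μ} {η} {ζ} T {w} 0≤w 0<α 0<β 0≤μ 0≤η μ≤α μ≤β ζ≤ profit =
    *-cancel-≤ (*-pos 0<s 0<s) (≤-by (+-mono-≤ bound (*-monoˡ (*-nonneg (nonNegative⁻¹ 4ℚ) 0≤μ) profit′)) eq)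
    where
    α = P w
    β = Q w
    s = α + β
    0<s : 0ℚ < s
    0<s = +-pos 0<α (<⇒≤ 0<β)
    bound = tiltedPot-bound 0<α 0<β 0≤μ 0≤η μ≤α μ≤β ζ≤ T 0≤w
    profit′ : tiltedPot α β η T w ≤ β * α + α * β
    profit′ = subst₂ _≤_ (pot-tilt η T (λ _ → refl))
      (trans (sum≡P+Q (tilt α β w)) (cong₂ _+_ (P-tilt (λ _ → refl)) (Q-tilt (λ _ → refl)))) profit
    l1 : ∀ s x μ t α β → s * s * x + (4ℚ * (β * β * α + α * α * β) + 4ℚ * μ * t + 4ℚ * μ * (β * α + α * β))
      ≡ s * s * x + 4ℚ * μ * (β * α + α * β) + 4ℚ * μ * t + (α + β) * (4ℚ * (α * β))
    l1 = solve-∀ ℚ-ring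
    l2 : ∀ s y k → y + s * (s * k) ≡ s * s * k + y
    l2 = solve-∀ ℚ-ring
    eq : s * s * pot ζ T w + (4ℚ * (β * β * α + α * α * β) + 4ℚ * μ * tiltedPot α β η T w + 4ℚ * μ * (β * α + α * β))
       ≡ s * s * hw w + (s * s * pot ζ T w + 4ℚ * μ * (β * α + α * β) + 4ℚ * μ * tiltedPot α β η T w)
    eq = trans (l1 s (pot ζ T w) μ (tiltedPot α β η T w) α β)
      (trans (cong (λ z → s * s * pot ζ T w + 4ℚ * μ * (β * α + α * β) + 4ℚ * μ * tiltedPot α β η T w + s * z) (sym (h-* α β 0<s)))
        (l2 s _ (hw w)))

  -- Trees of minimal potential

  -- The potential is additive over the two subtrees, so optimal subtrees may be chosen
  -- independently and only the root query is searched. The shallower optimum stays a candidate,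
  -- which makes `minPot` monotone in the depth. A concrete minimiser is kept because its root query
  -- is inspected later.
  best : ℚ → ℕ → Weights → DTree (Fin m) ⊤
  extensions : ℚ → ℕ → Weights → List (DTree (Fin m) ⊤)
  best η zero    w = leaf tt
  best η (suc n) w = argmin (λ T → pot η T w) (best η n w) (extensions η n w)
  extensions η n w = map (λ j → query j (best η n (lo j w)) (best η n (hi j w))) (allFin m)

  minPot : ℚ → ℕ → Weights → ℚ
  minPot η n w = pot η (best η n w) w

  minPot-suc : ∀ η n w → minPot η (suc n) w ≤ minPot η n w
  minPot-suc η n w = f[argmin]≤f[⊤] {f = λ T → pot η T w} (best η n w) (extensions η n w)

  minPot-query : ∀ η n w j → minPot η (suc n) w ≤ η * sum w + (minPot η n (lo j w) + minPot η n (hi j w))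
  minPot-query η n w j = All.lookup (f[argmin]≤f[xs] {f = λ T → pot η T w} (best η n w) (extensions η n w)) (∈-map⁺ _ (∈-allFin j))

  minPot≤hw : ∀ η n w → minPot η n w ≤ hw w
  minPot≤hw η zero    w = ≤-refl
  minPot≤hw η (suc n) w = ≤-trans (minPot-suc η n w) (minPot≤hw η n w)

  -- Iterating profitable trees down to small error

  err : DTree (Fin m) Bool → Weights → ℚ
  err T = mass (λ k → eval T (X k) xor Y k)

  err-query : ∀ j t u w → err (query j t u) w ≡ err t (lo j w) + err u (hi j w)
  err-query j t u w = trans (mass-cong w pointwise)
    (mass-if (λ k → X k j) (λ k → eval u (X k) xor Y k) (λ k → eval t (X k) xor Y k) w)
    where
    pointwise : ∀ k → (if X k j then eval u (X k) else eval t (X k)) xor Y k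
      ≡ (if X k j then eval u (X k) xor Y k else (eval t (X k) xor Y k))
    pointwise k with X k j
    ... | true  = refl
    ... | false = refl

  -- Error at price `B` plus expected depth at price `δ`. With `B` equal to `n` times `δ`, a path of
  -- `n` queries costs as much as a certain error, so cutting it there does no harm.
  loss : (B δ : ℚ) → DTree (Fin m) Bool → Weights → ℚ
  loss B δ (leaf o)      w = B * err (leaf o) w
  loss B δ (query j t u) w = δ * sum w + (loss B δ t (lo j w) + loss B δ u (hi j w))

  module _ {B δ : ℚ} (0≤B : 0ℚ ≤ B) (0≤δ : 0ℚ ≤ δ) where

    loss-nonneg : ∀ T {w} → NonNeg w → 0ℚ ≤ loss B δ T w
    loss-nonneg (leaf o)      0≤w = *-nonneg 0≤B (mass-nonneg (λ k → o xor Y k) 0≤w)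
    loss-nonneg (query j t u) 0≤w = +-nonneg (*-nonneg 0≤δ (sum-nonneg 0≤w))
      (+-nonneg (loss-nonneg t (lo-nonneg j 0≤w)) (loss-nonneg u (hi-nonneg j 0≤w)))

    -- Markov's inequality: a path cut after n queries has already paid n δ.
    err-truncate : ∀ n {r} → 0ℚ ≤ r → r + n ×ℚ δ ≡ B → ∀ T {w} → NonNeg w →
      B * err (truncate n true T) w ≤ loss B δ T w + r * sum w
    err-truncate n       0≤r eq (leaf o)      0≤w = ≤-sum⇐ (*-nonneg 0≤r (sum-nonneg 0≤w))
    err-truncate zero {r} 0≤r eq (query j t u) {w} 0≤w = begin
      B * err (leaf true) w                    ≤⟨ *-monoˡ 0≤B (mass≤sum (λ k → true xor Y k) 0≤w) ⟩
      B * sum w                                ≡⟨ cong (_* sum w) (trans (sym eq) (+-identityʳ r)) ⟩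
      r * sum w                                ≤⟨ ≤-sum⇐ (loss-nonneg (query j t u) 0≤w) ⟩
      r * sum w + loss B δ (query j t u) w     ≡⟨ +-comm (r * sum w) _ ⟩
      loss B δ (query j t u) w + r * sum w     ∎
      where open ≤-Reasoning
    err-truncate (suc n) {r} 0≤r eq (query j t u) {w} 0≤w = begin
      B * err (query j t′ u′) w                               ≡⟨ cong (B *_) (err-query j t′ u′ w) ⟩
      B * (err t′ (lo j w) + err u′ (hi j w))                 ≡⟨ *-distribˡ-+ B _ _ ⟩
      B * err t′ (lo j w) + B * err u′ (hi j w)               ≤⟨ +-mono-≤ (err-truncate n 0≤r+δ eq′ t (lo-nonneg j 0≤w))
                                                                          (err-truncate n 0≤r+δ eq′ u (hi-nonneg j 0≤w)) ⟩
      loss B δ t (lo j w) + (r + δ) * sum (lo j w) + (loss B δ u (hi j w) + (r + δ) * sum (hi j w))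
        ≡⟨ lemma (loss B δ t (lo j w)) (loss B δ u (hi j w)) r δ (sum (lo j w)) (sum (hi j w)) ⟩
      δ * (sum (lo j w) + sum (hi j w)) + (loss B δ t (lo j w) + loss B δ u (hi j w)) + r * (sum (lo j w) + sum (hi j w))
        ≡⟨ cong (λ s → δ * s + (loss B δ t (lo j w) + loss B δ u (hi j w)) + r * s) (sym (sum-split (λ k → X k j) w)) ⟩
      loss B δ (query j t u) w + r * sum w                    ∎
      where
      open ≤-Reasoning
      t′ = truncate n true t
      u′ = truncate n true u
      0≤r+δ = +-nonneg 0≤r 0≤δ
      eq′ : r + δ + n ×ℚ δ ≡ B
      eq′ = trans (+-assoc r δ (n ×ℚ δ)) eq
      lemma : ∀ a b r δ s t → a + (r + δ) * s + (b + (r + δ) * t) ≡ δ * (s + t) + (a + b) + r * (s + t)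
      lemma = solve-∀ ℚ-ring

    -- Each leaf of `T` is replaced by the tree that `next` supplies for the weights arriving there.
    -- The terms `hw` of these bounds are exactly the leaf terms of `pot δ T w`.
    graft : ∀ {O : Set} (T : DTree (Fin m) O) r →
      (∀ w → NonNeg w → ∃ λ T′ → loss B δ T′ w ≤ r * sum w + hw w) →
      ∀ w → NonNeg w → ∃ λ T′ → loss B δ T′ w ≤ r * sum w + pot δ T w
    graft (leaf _)      r next w 0≤w = next w 0≤w
    graft (query j t u) r next w 0≤w
      with graft t r next (lo j w) (lo-nonneg j 0≤w) | graft u r next (hi j w) (hi-nonneg j 0≤w)
    ... | t′ , t′≤ | u′ , u′≤ = query j t′ u′ , (begin
      δ * sum w + (loss B δ t′ (lo j w) + loss B δ u′ (hi j w))
        ≤⟨ +-monoʳ-≤ (δ * sum w) (+-mono-≤ t′≤ u′≤) ⟩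
      δ * sum w + (r * sum (lo j w) + pot δ t (lo j w) + (r * sum (hi j w) + pot δ u (hi j w)))
        ≡⟨ lemma (δ * sum w) r (sum (lo j w)) (sum (hi j w)) (pot δ t (lo j w)) (pot δ u (hi j w)) ⟩
      r * (sum (lo j w) + sum (hi j w)) + (δ * sum w + (pot δ t (lo j w) + pot δ u (hi j w)))
        ≡⟨ cong (λ s → r * s + (δ * sum w + (pot δ t (lo j w) + pot δ u (hi j w)))) (sym (sum-split (λ k → X k j) w)) ⟩
      r * sum w + pot δ (query j t u) w ∎)
      where
      open ≤-Reasoning
      lemma : ∀ d r s t x y → d + (r * s + x + (r * t + y)) ≡ r * (s + t) + (d + (x + y))
      lemma = solve-∀ ℚ-ring

    module _ {θ : ℚ} (0≤θ : 0ℚ ≤ θ)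
      (stage : ∀ w → NonNeg w → θ * sum w < P w → θ * sum w < Q w →
        ∃ λ (T : DTree (Fin m) ⊤) → pot δ T w + δ * sum w ≤ hw w) where

      stopped : ∀ {r w x} → 0ℚ ≤ r → NonNeg w → x ≤ B * (θ * sum w) → x ≤ (B * θ + r) * sum w + hw w
      stopped {r} {w} {x} 0≤r 0≤w x≤ = ≤-by
        (+-mono-≤ x≤ (+-nonneg (*-nonneg 0≤r (sum-nonneg 0≤w)) (h-nonneg (P-nonneg 0≤w) (Q-nonneg 0≤w))))
        (lemma x B θ r (sum w) (hw w))
        where
        lemma : ∀ x B θ r s k → x + (B * (θ * s) + (r * s + k)) ≡ (B * θ + r) * s + k + (x + 0ℚ)
        lemma = solve-∀ ℚ-ring

      -- `r` is what the earlier stages have drawn from the potential per unit of weight, `δ` each.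
      -- A stage lowers `hw` by at least `δ * sum w` net of its queries, so the claimed bound does
      -- not rise from one stage to the next. When no stage is left, `r` has reached `B` and pays
      -- even for an error on the whole mass.
      iterateStages : ∀ n {r} → 0ℚ ≤ r → r + n ×ℚ δ ≡ B → ∀ w → NonNeg w →
        ∃ λ T → loss B δ T w ≤ (B * θ + r) * sum w + hw w
      iterateStages n {r} 0≤r eq w 0≤w with P w ≤? θ * sum w | Q w ≤? θ * sum w
      ... | yes P≤ | _ = leaf false , stopped 0≤r 0≤w (*-monoˡ 0≤B P≤)
      ... | no _ | yes Q≤ = leaf true , stopped 0≤r 0≤w (*-monoˡ 0≤B Q≤)
      iterateStages zero {r} 0≤r eq w 0≤w | no _ | no _ = leaf true , ≤-by
        (+-mono-≤ (*-monoˡ 0≤B (mass≤sum (λ k → true xor Y k) 0≤w))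
          (+-nonneg (*-nonneg (*-nonneg 0≤B 0≤θ) (sum-nonneg 0≤w)) (h-nonneg (P-nonneg 0≤w) (Q-nonneg 0≤w))))
        (trans (cong (λ b → B * err (leaf true) w + (b * sum w + (B * θ * sum w + hw w))) (trans (sym eq) (+-identityʳ r)))
          (lemma (B * err (leaf true) w) (B * θ) r (sum w) (hw w)))
        where
        lemma : ∀ x y r s k → x + (r * s + (y * s + k)) ≡ (y + r) * s + k + (x + 0ℚ)
        lemma = solve-∀ ℚ-ring
      iterateStages (suc n) {r} 0≤r eq w 0≤w | no ¬P≤ | no ¬Q≤
        with stage w 0≤w (≰⇒> ¬P≤) (≰⇒> ¬Q≤)
      ... | T , profit with graft T (B * θ + (r + δ)) (iterateStages n (+-nonneg 0≤r 0≤δ) (trans (+-assoc r δ (n ×ℚ δ)) eq)) w 0≤w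
      ... | T′ , T′≤ = T′ , ≤-trans T′≤ (≤-by profit (lemma (B * θ) r δ (sum w) (pot δ T w) (hw w)))
        where
        lemma : ∀ y r δ s p k → (y + (r + δ)) * s + p + k ≡ (y + r) * s + k + (p + δ * s)
        lemma = solve-∀ ℚ-ring

-- Multiplicative weights: from weak trees to a randomized algorithm

12ℚ : ℚ
12ℚ = ℤ.+ 12 / 1

×ℚ-nonneg : ∀ {a} n → 0ℚ ≤ a → 0ℚ ≤ n ×ℚ a
×ℚ-nonneg zero    0≤a = ≤-refl
×ℚ-nonneg (suc n) 0≤a = +-nonneg 0≤a (×ℚ-nonneg n 0≤a)

×ℚ-monoˡ : ∀ {a m n} → 0ℚ ≤ a → m ℕ.≤ n → m ×ℚ a ≤ n ×ℚ a
×ℚ-monoˡ {n = n} 0≤a ℕ.z≤n = ×ℚ-nonneg n 0≤a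
×ℚ-monoˡ {a} 0≤a (ℕ.s≤s m≤n) = +-monoʳ-≤ a (×ℚ-monoˡ 0≤a m≤n)

×ℚ-* : ∀ n a → n ×ℚ a ≡ (n ×ℚ 1ℚ) * a
×ℚ-* n a = sym (trans (×-assoc-* n 1ℚ a) (cong (n ×ℚ_) (*-identityˡ a)))

bernoulli : ∀ {a} → 0ℚ ≤ a → ∀ n → 1ℚ + n ×ℚ a ≤ (1ℚ + a) ^ℚ n
bernoulli 0≤a zero = ≤-refl
bernoulli {a} 0≤a (suc n) = ≤-trans
  (≤-by (*-nonneg 0≤a (×ℚ-nonneg n 0≤a)) (lemma a (n ×ℚ a)))
  (*-monoˡ (+-nonneg (nonNegative⁻¹ 1ℚ) 0≤a) (bernoulli 0≤a n))
  where
  lemma : ∀ a x → 1ℚ + (a + x) + a * x ≡ (1ℚ + a) * (1ℚ + x) + 0ℚ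
  lemma = solve-∀ ℚ-ring

eval-cong : ∀ {I O : Set} (T : DTree I O) {x y : I → Bool} → (∀ i → x i ≡ y i) → eval T x ≡ eval T y
eval-cong (leaf _)      x≗y = refl
eval-cong (query i t u) {x} {y} x≗y rewrite x≗y i with y i
... | true  = eval-cong u x≗y
... | false = eval-cong t x≗y

fTask-correct : ∀ {m} (f : PartialFn m) x {y} → f x ≡ just y →
  ∀ b → Task.correct (fTask f) x b ≡ not (b xor y)
fTask-correct f x {y} eq b rewrite eq with y | b
... | true  | true  = refl
... | true  | false = refl
... | false | true  = refl
... | false | false = refl

Is-just⇒≡ : ∀ {A : Set} (x : Maybe A) → Is-just x → ∃ λ a → x ≡ just a
Is-just⇒≡ (just a) _ = a , refl

uniform : ∀ {I O : Set} → ℚ → List (DTree I O) → RandAlg I O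
uniform u = map (λ T → u , T)

totalWeight-uniform : ∀ {I O : Set} u (Ts : List (DTree I O)) → totalWeight (uniform u Ts) ≡ length Ts ×ℚ u
totalWeight-uniform u []       = refl
totalWeight-uniform u (T ∷ Ts) = cong (u +_) (totalWeight-uniform u Ts)

module Boosting {K m : ℕ} (X : Fin K → Fin m → Bool) (Y : Fin K → Bool) where
  open Block X Y

  mistakes : List (DTree (Fin m) Bool) → Fin K → ℕ
  mistakes []       k = 0
  mistakes (T ∷ Ts) k = (if eval T (X k) xor Y k then 1 else 0) ℕ.+ mistakes Ts k

  penalised : List (DTree (Fin m) Bool) → Weights {K}
  penalised []       k = 1ℚ
  penalised (T ∷ Ts) k = penalised Ts k + penalised Ts k when (eval T (X k) xor Y k)

  penalised≡2^ : ∀ Ts k → penalised Ts k ≡ 2ℚ ^ℚ mistakes Ts k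
  penalised≡2^ []       k = refl
  penalised≡2^ (T ∷ Ts) k with eval T (X k) xor Y k
  ... | true  = trans (cong (λ z → z + z) (penalised≡2^ Ts k)) (lemma (2ℚ ^ℚ mistakes Ts k))
    where
    lemma : ∀ z → z + z ≡ 2ℚ * z
    lemma = solve-∀ ℚ-ring
  ... | false = trans (+-identityʳ _) (penalised≡2^ Ts k)

  penalised-nonneg : ∀ Ts → NonNeg (penalised Ts)
  penalised-nonneg Ts k = subst (0ℚ ≤_) (sym (penalised≡2^ Ts k)) (^ℚ-nonneg (nonNegative⁻¹ 2ℚ) (mistakes Ts k))

  module _ {n : ℕ} (weak : ∀ w → NonNeg w →
    ∃ λ T → (∀ x → depthOn T x ℕ.≤ n) × err T w ≤ (ℤ.+ 1 / 6) * sum w) where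

    -- Each new tree is the weak learner's answer to the current penalties. Only the weight on which
    -- it errs is doubled, at most a sixth of the total.
    hedge : ∀ L → ∃ λ Ts → length Ts ≡ L × All (λ T → ∀ x → depthOn T x ℕ.≤ n) Ts ×
      sum (penalised Ts) ≤ (ℤ.+ 7 / 6) ^ℚ L * (K ×ℚ 1ℚ)
    hedge zero = [] , refl , [] , ≤-reflexive (trans (sum-replicate K) (sym (*-identityˡ (K ×ℚ 1ℚ))))
    hedge (suc L) with hedge L
    ... | Ts , len , shallow , bound with weak (penalised Ts) (penalised-nonneg Ts)
    ... | T , T-shallow , T-err = T ∷ Ts , cong suc len , T-shallow ∷ shallow , (begin
      sum (penalised (T ∷ Ts))            ≡⟨ ∑-distrib-+ w (on (λ k → eval T (X k) xor Y k) w) ⟩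
      sum w + err T w                     ≤⟨ +-monoʳ-≤ (sum w) T-err ⟩
      sum w + (ℤ.+ 1 / 6) * sum w             ≡⟨ lemma (sum w) ⟩
      (ℤ.+ 7 / 6) * sum w                     ≤⟨ *-monoˡ (nonNegative⁻¹ (ℤ.+ 7 / 6)) bound ⟩
      (ℤ.+ 7 / 6) * ((ℤ.+ 7 / 6) ^ℚ L * (K ×ℚ 1ℚ))  ≡⟨ sym (*-assoc (ℤ.+ 7 / 6) ((ℤ.+ 7 / 6) ^ℚ L) (K ×ℚ 1ℚ)) ⟩
      (ℤ.+ 7 / 6) ^ℚ suc L * (K ×ℚ 1ℚ)      ∎)
      where
      open ≤-Reasoning
      w = penalised Ts
      lemma : ∀ s → s + (ℤ.+ 1 / 6) * s ≡ (ℤ.+ 7 / 6) * s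
      lemma = solve-∀ ℚ-ring

    -- Otherwise some weight reaches 2 ^ rounds, while the total is at most (7/6) ^ (3 rounds) K and 5/4 (7/6)³ ≤ 2.
    few-mistakes : ∀ {Ts rounds} → suc K ℕ.* 4 ≡ rounds → sum (penalised Ts) ≤ (ℤ.+ 7 / 6) ^ℚ (rounds ℕ.* 3) * (K ×ℚ 1ℚ) →
      ∀ k → mistakes Ts k ℕ.≤ rounds
    few-mistakes {Ts} {rounds} rounds≡ bound k with mistakes Ts k ℕ.≤? rounds
    ... | yes le = le
    ... | no ¬le = contradiction (<-≤-trans 0<1+1 absurd) (<-irrefl refl)
      where
      open ≤-Reasoning
      c³ = (ℤ.+ 7 / 6) ^ℚ 3
      0<1+1 : 0ℚ < 1ℚ + 1ℚ
      0<1+1 = positive⁻¹ (1ℚ + 1ℚ)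
      chain : c³ ^ℚ rounds * (ℤ.+ 5 / 4) ^ℚ rounds ≤ c³ ^ℚ rounds * (K ×ℚ 1ℚ)
      chain = begin
        c³ ^ℚ rounds * (ℤ.+ 5 / 4) ^ℚ rounds   ≡⟨ sym (^ℚ-distrib-* c³ (ℤ.+ 5 / 4) rounds) ⟩
        (c³ * (ℤ.+ 5 / 4)) ^ℚ rounds             ≤⟨ ^ℚ-monoˡ {b = 2ℚ} (nonNegative⁻¹ (c³ * (ℤ.+ 5 / 4))) (≤ᵇ⇒≤ _) rounds ⟩
        2ℚ ^ℚ rounds                         ≤⟨ ^ℚ-monoʳ {2ℚ} (≤ᵇ⇒≤ _) (ℕ.<⇒≤ (ℕ.≰⇒> ¬le)) ⟩
        2ℚ ^ℚ mistakes Ts k                  ≡⟨ sym (penalised≡2^ Ts k) ⟩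
        penalised Ts k                       ≤⟨ term≤sum (penalised-nonneg Ts) k ⟩
        sum (penalised Ts)                   ≤⟨ bound ⟩
        (ℤ.+ 7 / 6) ^ℚ (rounds ℕ.* 3) * (K ×ℚ 1ℚ)  ≡⟨ cong (_* (K ×ℚ 1ℚ)) (^ℚ-* (ℤ.+ 7 / 6) rounds 3) ⟩
        c³ ^ℚ rounds * (K ×ℚ 1ℚ)             ∎
      grow : 1ℚ + (1ℚ + K ×ℚ 1ℚ) ≤ K ×ℚ 1ℚ
      grow = begin
        1ℚ + suc K ×ℚ 1ℚ               ≡⟨ cong (1ℚ +_) (trans (×-assocˡ (ℤ.+ 1 / 4) (suc K) 4) (cong (_×ℚ (ℤ.+ 1 / 4)) rounds≡)) ⟩
        1ℚ + rounds ×ℚ (ℤ.+ 1 / 4)       ≤⟨ bernoulli (nonNegative⁻¹ (ℤ.+ 1 / 4)) rounds ⟩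
        (ℤ.+ 5 / 4) ^ℚ rounds            ≤⟨ *-cancel-≤ (^ℚ-pos (positive⁻¹ c³) rounds) chain ⟩
        K ×ℚ 1ℚ                        ∎
      absurd : 1ℚ + 1ℚ ≤ 0ℚ
      absurd = ≤-by grow (lemma (K ×ℚ 1ℚ))
        where
        lemma : ∀ z → 1ℚ + 1ℚ + z ≡ 0ℚ + (1ℚ + (1ℚ + z))
        lemma = solve-∀ ℚ-ring

    Committee : ℕ → Set
    Committee R = ∃ λ Ts → length Ts ≡ R ℕ.* 3 ×
      All (λ T → ∀ x → depthOn T x ℕ.≤ n) Ts × (∀ k → mistakes Ts k ℕ.≤ R)

    committee : ∃ λ R → 1 ℕ.≤ R × Committee R
    -- With `4 (K + 1)` rounds Bernoulli's inequality gives `(5/4) ^ rounds ≥ K + 2`, more than the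
    -- initial total weight `K`.
    committee = suc K ℕ.* 4 , ℕ.s≤s ℕ.z≤n , go refl
      where
      go : ∀ {R} → suc K ℕ.* 4 ≡ R → Committee R
      go {R} R≡ with hedge (R ℕ.* 3)
      ... | Ts , len , shallow , bound = Ts , len , shallow , few-mistakes {Ts} R≡ bound

    module _ {f : PartialFn m} (cover : ∀ x b → f x ≡ just b → ∃ λ k → (∀ j → X k j ≡ x j) × Y k ≡ b) where

      success+mistakes : ∀ u {x k} → f x ≡ just (Y k) → (∀ j → X k j ≡ x j) → ∀ Ts →
        successProb (fTask f) (uniform u Ts) x + mistakes Ts k ×ℚ u ≡ length Ts ×ℚ u
      success+mistakes u fx≡ Xk≗ []       = refl
      success+mistakes u {x} {k} fx≡ Xk≗ (T ∷ Ts)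
        rewrite fTask-correct f x fx≡ (eval T x) | sym (eval-cong T Xk≗)
        with eval T (X k) xor Y k | success+mistakes u fx≡ Xk≗ Ts
      ... | true  | ih = trans (lemma (successProb (fTask f) (uniform u Ts) x) u (mistakes Ts k ×ℚ u)) (cong (u +_) ih)
        where
        lemma : ∀ s u m → 0ℚ + s + (u + m) ≡ u + (s + m)
        lemma = solve-∀ ℚ-ring
      ... | false | ih = trans (+-assoc u (successProb (fTask f) (uniform u Ts) x) _) (cong (u +_) ih)

      accuracy : ∀ {u L Ts} → 0ℚ ≤ u → L ×ℚ u ≡ 1ℚ → length Ts ≡ L → (∀ k → mistakes Ts k ℕ.* 3 ℕ.≤ L) →
        ∀ x → Is-just (f x) → twoThirds ≤ successProb (fTask f) (uniform u Ts) x
      accuracy {u} {L} {Ts} 0≤u Lu≡1 len few x dom with Is-just⇒≡ (f x) dom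
      ... | b , fx≡ with cover x b fx≡
      ... | k , Xk≗ , refl = ≤-by mistakes≤
        (sym (trans (success+mistakes u fx≡ Xk≗ Ts) (trans (cong (_×ℚ u) len) Lu≡1)))
        where
        mistakes≤ : mistakes Ts k ×ℚ u ≤ (ℤ.+ 1 / 3)
        mistakes≤ = *-cancel-≤ (positive⁻¹ (ℤ.+ 3 / 1)) (begin
          (ℤ.+ 3 / 1) * (mistakes Ts k ×ℚ u)         ≡⟨ cong ((ℤ.+ 3 / 1) *_) (×ℚ-* (mistakes Ts k) u) ⟩
          (ℤ.+ 3 / 1) * ((mistakes Ts k ×ℚ 1ℚ) * u)  ≡⟨ lemma (mistakes Ts k ×ℚ 1ℚ) u ⟩
          (mistakes Ts k ×ℚ 1ℚ) * (3 ×ℚ u)           ≡⟨ sym (×ℚ-* (mistakes Ts k) (3 ×ℚ u)) ⟩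
          mistakes Ts k ×ℚ (3 ×ℚ u)                  ≡⟨ ×-assocˡ u (mistakes Ts k) 3 ⟩
          (mistakes Ts k ℕ.* 3) ×ℚ u                 ≤⟨ ×ℚ-monoˡ 0≤u (few k) ⟩
          L ×ℚ u                                     ≡⟨ Lu≡1 ⟩
          (ℤ.+ 3 / 1) * (ℤ.+ 1 / 3)                  ∎)
          where
          open ≤-Reasoning
          lemma : ∀ z u → (ℤ.+ 3 / 1) * (z * u) ≡ z * (u + (u + (u + 0ℚ)))
          lemma = solve-∀ ℚ-ring

      uniform-solves : ∀ R → 1 ℕ.≤ R → Committee R → Solves (fTask f) twoThirds n
      uniform-solves R 1≤R (Ts , len , shallow , few) =
        uniform u Ts , (All.map⁺ (All.universal (λ _ → inv-pos 0<L) Ts) , weight-one) ,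
        (λ x _ pt∈ → All.lookup {P = λ pt → ∀ x → depthOn (proj₂ pt) x ℕ.≤ n} (All.map⁺ shallow) pt∈ x) ,
        accuracy {Ts = Ts} (<⇒≤ (inv-pos 0<L)) Lu≡1 len (λ k → ℕ.*-monoˡ-≤ 3 (few k))
        where
        L = R ℕ.* 3
        0<L : 0ℚ < L ×ℚ 1ℚ
        0<L = <-≤-trans (positive⁻¹ (1 ×ℚ 1ℚ)) (×ℚ-monoˡ (nonNegative⁻¹ 1ℚ) (ℕ.≤-trans 1≤R (ℕ.m≤m*n R 3)))
        u = inv (L ×ℚ 1ℚ)
        Lu≡1 : L ×ℚ u ≡ 1ℚ
        Lu≡1 = trans (×ℚ-* L u) (*-inv 0<L)
        weight-one : totalWeight (uniform u Ts) ≡ 1ℚ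
        weight-one = trans (totalWeight-uniform u Ts) (trans (cong (_×ℚ u) len) Lu≡1)

      boost : Solves (fTask f) twoThirds n
      boost = uniform-solves (proj₁ committee) (proj₁ (proj₂ committee)) (proj₂ (proj₂ committee))

-- Sums over bit strings and products over blocks

listSum : ∀ {A : Set} → (A → ℚ) → List A → ℚ
listSum g []       = 0ℚ
listSum g (x ∷ xs) = g x + listSum g xs

listSum-++ : ∀ {A : Set} (g : A → ℚ) xs ys → listSum g (xs ++ ys) ≡ listSum g xs + listSum g ys
listSum-++ g []       ys = sym (+-identityˡ _)
listSum-++ g (x ∷ xs) ys = trans (cong (g x +_) (listSum-++ g xs ys)) (sym (+-assoc (g x) _ _))

listSum-map : ∀ {A B : Set} (g : B → ℚ) (φ : A → B) xs → listSum g (map φ xs) ≡ listSum (g ∘ φ) xs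
listSum-map g φ []       = refl
listSum-map g φ (x ∷ xs) = cong (g (φ x) +_) (listSum-map g φ xs)

listSum-cong : ∀ {A : Set} {g g′ : A → ℚ} → (∀ x → g x ≡ g′ x) → ∀ xs → listSum g xs ≡ listSum g′ xs
listSum-cong eq []       = refl
listSum-cong eq (x ∷ xs) = cong₂ _+_ (eq x) (listSum-cong eq xs)

listSum-mono : ∀ {A : Set} {g g′ : A → ℚ} → (∀ x → g x ≤ g′ x) → ∀ xs → listSum g xs ≤ listSum g′ xs
listSum-mono le []       = ≤-refl
listSum-mono le (x ∷ xs) = +-mono-≤ (le x) (listSum-mono le xs)

listSum-+ : ∀ {A : Set} (g g′ : A → ℚ) xs → listSum (λ x → g x + g′ x) xs ≡ listSum g xs + listSum g′ xs
listSum-+ g g′ []       = refl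
listSum-+ g g′ (x ∷ xs) = trans (cong (g x + g′ x +_) (listSum-+ g g′ xs)) (lemma (g x) (g′ x) _ _)
  where
  lemma : ∀ a b c d → a + b + (c + d) ≡ a + c + (b + d)
  lemma = solve-∀ ℚ-ring

listSum-* : ∀ {A : Set} c (g : A → ℚ) xs → listSum (λ x → c * g x) xs ≡ c * listSum g xs
listSum-* c g []       = sym (*-zeroʳ c)
listSum-* c g (x ∷ xs) = trans (cong (c * g x +_) (listSum-* c g xs)) (sym (*-distribˡ-+ c (g x) _))

listSum-when : ∀ {A : Set} (S : A → Bool) xs →
  listSum (λ x → 1ℚ when S x) xs ≡ length (filter (λ x → Data.Bool._≟_ (S x) true) xs) ×ℚ 1ℚ
listSum-when S []       = refl
listSum-when S (x ∷ xs) with S x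
... | true  = cong (1ℚ +_) (listSum-when S xs)
... | false = trans (+-identityˡ _) (listSum-when S xs)

bitSum : ∀ {n} → (Vec Bool n → ℚ) → ℚ
bitSum {n} g = listSum g (allBits n)

bitSum-suc : ∀ {n} (g : Vec Bool (suc n) → ℚ) →
  bitSum g ≡ bitSum (λ y → g (false ∷ y)) + bitSum (λ y → g (true ∷ y))
bitSum-suc {n} g = trans (listSum-++ g (map (false ∷_) (allBits n)) (map (true ∷_) (allBits n)))
  (cong₂ _+_ (listSum-map g (false ∷_) (allBits n)) (listSum-map g (true ∷_) (allBits n)))

∏ : ∀ {A : Set} {n} → (A → ℚ) → Vec A n → ℚ
∏ φ []       = 1ℚ
∏ φ (w ∷ ws) = φ w * ∏ φ ws

All-updateAt : ∀ {A : Set} {Good : A → Set} {g : A → A} {n} {ws : Vec A n} i →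
  (∀ w → Good w → Good (g w)) → VAll.All Good ws → VAll.All Good (updateAt ws i g)
All-updateAt zero    pres (p ∷ ps) = pres _ p ∷ ps
All-updateAt (suc i) pres (p ∷ ps) = p ∷ All-updateAt i pres ps

All-replicate : ∀ {A : Set} {Good : A → Set} n {w} → Good w → VAll.All Good (replicate n w)
All-replicate zero    g = []
All-replicate (suc n) g = g ∷ All-replicate n g

∏-pos : ∀ {A : Set} {φ : A → ℚ} {n} {ws : Vec A n} → VAll.All (λ w → 0ℚ < φ w) ws → 0ℚ < ∏ φ ws
∏-pos []       = positive⁻¹ 1ℚ
∏-pos (p ∷ ps) = *-pos p (∏-pos ps)

module _ {A : Set} {Good : A → Set} {φ ψ : A → ℚ} (0≤φ : ∀ w → Good w → 0ℚ ≤ φ w) (φ≤ψ : ∀ w → Good w → φ w ≤ ψ w) where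

  ∏-nonneg : ∀ {n} {ws : Vec A n} → VAll.All Good ws → 0ℚ ≤ ∏ φ ws
  ∏-nonneg []       = nonNegative⁻¹ 1ℚ
  ∏-nonneg (g ∷ gs) = *-nonneg (0≤φ _ g) (∏-nonneg gs)

  ∏-mono : ∀ {n} {ws : Vec A n} → VAll.All Good ws → ∏ φ ws ≤ ∏ ψ ws
  ∏-mono []       = ≤-refl
  ∏-mono (g ∷ gs) = *-mono (≤-trans (0≤φ _ g) (φ≤ψ _ g)) (∏-nonneg gs) (φ≤ψ _ g) (∏-mono gs)

  -- One query in a product: the queried factor splits in two at the cost `c`, and every other
  -- factor merely passes from `φ` to `ψ`. In the application these are advantages for depths `d`
  -- and `suc d`.
  ∏-updateAt-mono : ∀ {c a b} → (∀ w → Good w → φ (a w) + φ (b w) ≤ c * ψ w) →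
    ∀ {n} {ws : Vec A n} → VAll.All Good ws → ∀ i →
    0ℚ ≤ c → (∀ w → Good w → 0ℚ ≤ φ (a w) + φ (b w)) → (∀ w → Good w → Good (a w)) → (∀ w → Good w → Good (b w)) →
    ∏ φ (updateAt ws i a) + ∏ φ (updateAt ws i b) ≤ c * ∏ ψ ws
  ∏-updateAt-mono {c} {a} {b} le {ws = w ∷ ws} (g ∷ gs) zero 0≤c 0≤ ga gb = begin
    φ (a w) * ∏ φ ws + φ (b w) * ∏ φ ws  ≡⟨ sym (*-distribʳ-+ (∏ φ ws) (φ (a w)) (φ (b w))) ⟩
    (φ (a w) + φ (b w)) * ∏ φ ws         ≤⟨ *-mono (≤-trans (0≤ w g) (le w g)) (∏-nonneg gs) (le w g) (∏-mono gs) ⟩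
    c * ψ w * ∏ ψ ws                     ≡⟨ *-assoc c (ψ w) (∏ ψ ws) ⟩
    c * (ψ w * ∏ ψ ws)                   ∎
    where open ≤-Reasoning
  ∏-updateAt-mono {c} {a} {b} le {ws = w ∷ ws} (g ∷ gs) (suc i) 0≤c 0≤ ga gb = begin
    φ w * ∏ φ (updateAt ws i a) + φ w * ∏ φ (updateAt ws i b)  ≡⟨ sym (*-distribˡ-+ (φ w) _ _) ⟩
    φ w * (∏ φ (updateAt ws i a) + ∏ φ (updateAt ws i b))
      ≤⟨ *-mono (≤-trans (0≤φ w g) (φ≤ψ w g)) (+-nonneg (∏-nonneg (All-updateAt i ga gs)) (∏-nonneg (All-updateAt i gb gs)))
           (φ≤ψ w g) (∏-updateAt-mono le gs i 0≤c 0≤ ga gb) ⟩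
    ψ w * (c * ∏ ψ ws)                                         ≡⟨ lemma (ψ w) c (∏ ψ ws) ⟩
    c * (ψ w * ∏ ψ ws)                                         ∎
    where
    open ≤-Reasoning
    lemma : ∀ x c y → x * (c * y) ≡ c * (x * y)
    lemma = solve-∀ ℚ-ring

-- Independent blocks: the product measure

module _ {K : ℕ} where

  -- The integral against the product measure of `ws`, whose total mass is `∏ sum ws` and need not
  -- be 1.
  expect : ∀ {n} → Vec (Weights {K}) n → (Vec (Fin K) n → ℚ) → ℚ
  expect []       F = F []
  expect (w ∷ ws) F = sum (λ k → w k * expect ws (λ ξ → F (k ∷ ξ)))

  expect-cong : ∀ {n} (ws : Vec (Weights {K}) n) {F G} → (∀ ξ → F ξ ≡ G ξ) → expect ws F ≡ expect ws G
  expect-cong []       eq = eq []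
  expect-cong (w ∷ ws) eq = sum-cong-≗ (λ k → cong (w k *_) (expect-cong ws (λ ξ → eq (k ∷ ξ))))

  expect-mono : ∀ {n} {ws : Vec (Weights {K}) n} → VAll.All NonNeg ws → ∀ {F G} → (∀ ξ → F ξ ≤ G ξ) → expect ws F ≤ expect ws G
  expect-mono []       le = le []
  expect-mono (g ∷ gs) le = sum-mono (λ k → *-monoˡ (g k) (expect-mono gs (λ ξ → le (k ∷ ξ))))

  expect-+ : ∀ {n} (ws : Vec (Weights {K}) n) F G → expect ws (λ ξ → F ξ + G ξ) ≡ expect ws F + expect ws G
  expect-+ []       F G = refl
  expect-+ (w ∷ ws) F G = trans
    (sum-cong-≗ (λ k → trans (cong (w k *_) (expect-+ ws (λ ξ → F (k ∷ ξ)) (λ ξ → G (k ∷ ξ)))) (*-distribˡ-+ (w k) _ _)))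
    (∑-distrib-+ (λ k → w k * expect ws (λ ξ → F (k ∷ ξ))) (λ k → w k * expect ws (λ ξ → G (k ∷ ξ))))

  expect-* : ∀ {n} (ws : Vec (Weights {K}) n) c F → expect ws (λ ξ → c * F ξ) ≡ c * expect ws F
  expect-* []       c F = refl
  expect-* (w ∷ ws) c F = trans
    (sum-cong-≗ (λ k → trans (cong (w k *_) (expect-* ws c (λ ξ → F (k ∷ ξ)))) (lemma (w k) c _)))
    (sym (*-distribˡ-sum c (λ k → w k * expect ws (λ ξ → F (k ∷ ξ)))))
    where
    lemma : ∀ x c y → x * (c * y) ≡ c * (x * y)
    lemma = solve-∀ ℚ-ring

  expect-1 : ∀ {n} (ws : Vec (Weights {K}) n) → expect ws (λ _ → 1ℚ) ≡ ∏ sum ws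
  expect-1 []       = refl
  expect-1 (w ∷ ws) = trans (sum-cong-≗ (λ k → cong (w k *_) (expect-1 ws))) (sym (*-distribʳ-sum (∏ sum ws) w))

  -- Either answer to a query in block `i` restricts only the `i`-th factor. Blocks thus stay
  -- independent along every path of an adaptive tree.
  expect-if : ∀ {n} (ws : Vec (Weights {K}) n) i c F G →
    expect ws (λ ξ → if c (lookup ξ i) then F ξ else G ξ)
      ≡ expect (updateAt ws i (on (not ∘ c))) G + expect (updateAt ws i (on c)) F
  expect-if (w ∷ ws) zero c F G = trans (sum-cong-≗ pointwise)
    (∑-distrib-+ (λ k → (w k when not (c k)) * expect ws (λ ξ → G (k ∷ ξ))) (λ k → (w k when c k) * expect ws (λ ξ → F (k ∷ ξ))))
    where
    pointwise : ∀ k → w k * expect ws (λ ξ → if c k then F (k ∷ ξ) else G (k ∷ ξ))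
      ≡ (w k when not (c k)) * expect ws (λ ξ → G (k ∷ ξ)) + (w k when c k) * expect ws (λ ξ → F (k ∷ ξ))
    pointwise k with c k
    ... | true  = sym (trans (cong (_+ w k * expect ws (λ ξ → F (k ∷ ξ))) (*-zeroˡ (expect ws (λ ξ → G (k ∷ ξ))))) (+-identityˡ _))
    ... | false = sym (trans (cong (w k * expect ws (λ ξ → G (k ∷ ξ)) +_) (*-zeroˡ (expect ws (λ ξ → F (k ∷ ξ))))) (+-identityʳ _))
  expect-if (w ∷ ws) (suc i) c F G = trans
    (sum-cong-≗ (λ k → trans (cong (w k *_) (expect-if ws i c (λ ξ → F (k ∷ ξ)) (λ ξ → G (k ∷ ξ)))) (*-distribˡ-+ (w k) _ _)))
    (∑-distrib-+ (λ k → w k * expect (updateAt ws i (on (not ∘ c))) (λ ξ → G (k ∷ ξ)))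
                 (λ k → w k * expect (updateAt ws i (on c)) (λ ξ → F (k ∷ ξ))))

-- Second moments and the success of a list

module ListDecoding {K m : ℕ} (X : Fin K → Fin m → Bool) (Y : Fin K → Bool) where
  open Block X Y

  -- The push-forward of the product measure to label vectors.
  labelMass : ∀ {n} → Vec (Weights {K}) n → Vec Bool n → ℚ
  labelMass []       []      = 1ℚ
  labelMass (w ∷ ws) (b ∷ y) = (if b then P w else Q w) * labelMass ws y

  expect-labels : ∀ {n} (ws : Vec (Weights {K}) n) (g : Vec Bool n → ℚ) →
    expect ws (λ ξ → g (Vec.map Y ξ)) ≡ bitSum (λ y → labelMass ws y * g y)
  expect-labels []       g = lemma (g [])
    where
    lemma : ∀ x → x ≡ 1ℚ * x + 0ℚ
    lemma = solve-∀ ℚ-ring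
  expect-labels (w ∷ ws) g = begin
    sum (λ k → w k * expect ws (λ ξ → g (Y k ∷ Vec.map Y ξ)))      ≡⟨ sum-cong-≗ pointwise ⟩
    sum (λ k → on (not ∘ Y) w k * E false + on Y w k * E true)     ≡⟨ ∑-distrib-+ (λ k → on (not ∘ Y) w k * E false) (λ k → on Y w k * E true) ⟩
    sum (λ k → on (not ∘ Y) w k * E false) + sum (λ k → on Y w k * E true)
      ≡⟨ cong₂ _+_ (sym (*-distribʳ-sum (E false) (on (not ∘ Y) w))) (sym (*-distribʳ-sum (E true) (on Y w))) ⟩
    Q w * E false + P w * E true                                   ≡⟨ cong₂ _+_ (term (Q w) false) (term (P w) true) ⟩
    bitSum (λ y → Q w * labelMass ws y * g (false ∷ y)) + bitSum (λ y → P w * labelMass ws y * g (true ∷ y))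
      ≡⟨ sym (bitSum-suc (λ y → labelMass (w ∷ ws) y * g y)) ⟩
    bitSum (λ y → labelMass (w ∷ ws) y * g y)                      ∎
    where
    open ≡-Reasoning
    E : Bool → ℚ
    E b = expect ws (λ ξ → g (b ∷ Vec.map Y ξ))
    pointwise : ∀ k → w k * E (Y k) ≡ on (not ∘ Y) w k * E false + on Y w k * E true
    pointwise k with Y k
    ... | true  = sym (trans (cong (_+ w k * E true) (*-zeroˡ (E false))) (+-identityˡ _))
    ... | false = sym (trans (cong (w k * E false +_) (*-zeroˡ (E true))) (+-identityʳ _))
    term : ∀ c b → c * E b ≡ bitSum (λ y → c * labelMass ws y * g (b ∷ y))
    term c b = trans (cong (c *_) (expect-labels ws (λ y → g (b ∷ y))))
      (trans (sym (listSum-* c (λ y → labelMass ws y * g (b ∷ y)) (allBits _)))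
        (listSum-cong (λ y → sym (*-assoc c (labelMass ws y) (g (b ∷ y)))) (allBits _)))

  advantage : ℚ → ℕ → Weights {K} → ℚ
  advantage η d w = sum w + sum w - minPot η d w

  -- Both sides factor over the blocks, and for one block `2 (P² + Q²) = (P + Q) (2 (P + Q) - h)`.
  bitSum-labelMass² : ∀ {n} {ws : Vec (Weights {K}) n} → VAll.All NonNeg ws →
    2ℚ ^ℚ n * bitSum (λ y → labelMass ws y * labelMass ws y) ≡ ∏ sum ws * ∏ (advantage 0ℚ 0) ws
  bitSum-labelMass² [] = refl
  bitSum-labelMass² {suc n} {w ∷ ws} (0≤w ∷ gs) = begin
    2ℚ * 2ℚ ^ℚ n * bitSum (λ y → L (w ∷ ws) y * L (w ∷ ws) y)
      ≡⟨ cong (2ℚ * 2ℚ ^ℚ n *_) (trans (bitSum-suc (λ y → L (w ∷ ws) y * L (w ∷ ws) y)) (cong₂ _+_ (square (Q w)) (square (P w)))) ⟩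
    2ℚ * 2ℚ ^ℚ n * (Q w * Q w * Λ + P w * P w * Λ)   ≡⟨ l1 (2ℚ ^ℚ n) (P w) (Q w) Λ ⟩
    2ℚ * (P w * P w + Q w * Q w) * (2ℚ ^ℚ n * Λ)     ≡⟨ cong₂ _*_ key (bitSum-labelMass² gs) ⟩
    sum w * V w * (∏ sum ws * ∏ V ws)                ≡⟨ l2 (sum w) (V w) (∏ sum ws) (∏ V ws) ⟩
    sum w * ∏ sum ws * (V w * ∏ V ws)                ∎
    where
    open ≡-Reasoning
    L = labelMass
    V = advantage 0ℚ 0
    Λ = bitSum (λ y → L ws y * L ws y)
    square : ∀ c → bitSum (λ y → c * L ws y * (c * L ws y)) ≡ c * c * Λ
    square c = trans (listSum-cong (λ y → lemma c (L ws y)) (allBits n)) (listSum-* (c * c) _ (allBits n))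
      where
      lemma : ∀ c x → c * x * (c * x) ≡ c * c * (x * x)
      lemma = solve-∀ ℚ-ring
    l1 : ∀ t p q z → 2ℚ * t * (q * q * z + p * p * z) ≡ 2ℚ * (p * p + q * q) * (t * z)
    l1 = solve-∀ ℚ-ring
    l2 : ∀ a b c d → a * b * (c * d) ≡ a * c * (b * d)
    l2 = solve-∀ ℚ-ring
    key : 2ℚ * (P w * P w + Q w * Q w) ≡ sum w * V w
    key = begin
      2ℚ * (P w * P w + Q w * Q w)                            ≡⟨ k1 (P w) (Q w) ⟩
      (P w + Q w) * (P w + Q w + (P w + Q w)) - 4ℚ * (P w * Q w)
        ≡⟨ cong (λ z → (P w + Q w) * (P w + Q w + (P w + Q w)) - z) (sym (h-*-nonneg (P-nonneg 0≤w) (Q-nonneg 0≤w))) ⟩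
      (P w + Q w) * (P w + Q w + (P w + Q w)) - (P w + Q w) * hw w  ≡⟨ k2 (P w + Q w) (hw w) ⟩
      (P w + Q w) * (P w + Q w + (P w + Q w) - hw w)          ≡⟨ cong (λ s → s * (s + s - hw w)) (sym (sum≡P+Q w)) ⟩
      sum w * V w                                             ∎
      where
      k1 : ∀ p q → 2ℚ * (p * p + q * q) ≡ (p + q) * (p + q + (p + q)) - 4ℚ * (p * q)
      k1 = solve-∀ ℚ-ring
      k2 : ∀ s h → s * (s + s) - s * h ≡ s * (s + s - h)
      k2 = solve-∀ ℚ-ring

  sum-∏-nonneg : ∀ {n} {ws : Vec (Weights {K}) n} → VAll.All NonNeg ws → 0ℚ ≤ ∏ sum ws
  sum-∏-nonneg = ∏-nonneg {ψ = sum} (λ _ → sum-nonneg) (λ _ _ → ≤-refl)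

  sum≤advantage : ∀ η d w → NonNeg w → sum w ≤ advantage η d w
  sum≤advantage η d w 0≤w = ≤-by (≤-trans (minPot≤hw η d w) (hw≤sum 0≤w)) (lemma (sum w) (minPot η d w))
    where
    lemma : ∀ s m → s + s ≡ s + s - m + m
    lemma = solve-∀ ℚ-ring

  advantage-nonneg : ∀ η d w → NonNeg w → 0ℚ ≤ advantage η d w
  advantage-nonneg η d w 0≤w = ≤-trans (sum-nonneg 0≤w) (sum≤advantage η d w 0≤w)

  -- 2 t M x ≤ (t x)² + M² for every y in S, with x = labelMass y, M = ∏ sum and t = 2ⁿ a.
  listBound : ∀ {n} {ws : Vec (Weights {K}) n} → VAll.All NonNeg ws → ∀ {a b} → 0ℚ < a → 0ℚ ≤ b →
    ∀ S → card S ×ℚ 1ℚ ≡ 2ℚ ^ℚ n * (a * b) →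
    2ℚ * expect ws (λ ξ → 1ℚ when S (Vec.map Y ξ)) ≤ a * ∏ (advantage 0ℚ 0) ws + b * ∏ sum ws
  listBound {n} {ws} gs {a} {b} 0<a 0≤b S size = ≡0⊎pos (sum-∏-nonneg gs) degenerate generic
    where
    open ≤-Reasoning
    M = ∏ sum ws
    V = ∏ (advantage 0ℚ 0) ws
    E = expect ws (λ ξ → 1ℚ when S (Vec.map Y ξ))
    N = 2ℚ ^ℚ n
    L = labelMass ws
    Λ = bitSum (λ y → L y * L y)
    0≤V : 0ℚ ≤ V
    0≤V = ∏-nonneg {ψ = advantage 0ℚ 0} (advantage-nonneg 0ℚ 0) (λ _ _ → ≤-refl) gs
    degenerate : M ≡ 0ℚ → 2ℚ * E ≤ a * V + b * M
    degenerate M≡0 = begin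
      2ℚ * E         ≤⟨ *-monoˡ (nonNegative⁻¹ 2ℚ) (expect-mono gs (λ ξ → when≤ (S (Vec.map Y ξ)) (nonNegative⁻¹ 1ℚ))) ⟩
      2ℚ * expect ws (λ _ → 1ℚ)  ≡⟨ cong (2ℚ *_) (trans (expect-1 ws) M≡0) ⟩
      0ℚ             ≤⟨ +-nonneg (*-nonneg (<⇒≤ 0<a) 0≤V) (*-nonneg 0≤b (sum-∏-nonneg gs)) ⟩
      a * V + b * M  ∎
    generic : 0ℚ < M → 2ℚ * E ≤ a * V + b * M
    generic 0<M = *-cancel-≤ (*-pos (*-pos (^ℚ-pos (positive⁻¹ 2ℚ) n) 0<a) 0<M) (begin
      N * a * M * (2ℚ * E)                        ≡⟨ l1 (N * a) M E ⟩
      2ℚ * (N * a) * M * E                        ≡⟨ cong (2ℚ * (N * a) * M *_) (expect-labels ws (λ y → 1ℚ when S y)) ⟩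
      2ℚ * (N * a) * M * bitSum (λ y → L y * (1ℚ when S y))  ≡⟨ sym (listSum-* (2ℚ * (N * a) * M) (λ y → L y * (1ℚ when S y)) (allBits n)) ⟩
      bitSum (λ y → 2ℚ * (N * a) * M * (L y * (1ℚ when S y)))  ≤⟨ listSum-mono (λ y → am-gm (L y) (S y)) (allBits n) ⟩
      bitSum (λ y → N * a * (N * a) * (L y * L y) + M * M * (1ℚ when S y))
        ≡⟨ trans (listSum-+ (λ y → N * a * (N * a) * (L y * L y)) (λ y → M * M * (1ℚ when S y)) (allBits n))
             (cong₂ _+_ (listSum-* (N * a * (N * a)) (λ y → L y * L y) (allBits n)) (listSum-* (M * M) (λ y → 1ℚ when S y) (allBits n))) ⟩
      N * a * (N * a) * Λ + M * M * bitSum (λ y → 1ℚ when S y)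
        ≡⟨ cong (λ z → N * a * (N * a) * Λ + M * M * z) (trans (listSum-when S (allBits n)) size) ⟩
      N * a * (N * a) * Λ + M * M * (N * (a * b)) ≡⟨ l2 N a Λ M b ⟩
      N * a * (a * (N * Λ) + b * M * M)           ≡⟨ cong (λ z → N * a * (a * z + b * M * M)) (bitSum-labelMass² gs) ⟩
      N * a * (a * (M * V) + b * M * M)           ≡⟨ l3 (N * a) a M V b ⟩
      N * a * M * (a * V + b * M)                 ∎)
      where
      l1 : ∀ t M E → t * M * (2ℚ * E) ≡ 2ℚ * t * M * E
      l1 = solve-∀ ℚ-ring
      l2 : ∀ N a Λ M b → N * a * (N * a) * Λ + M * M * (N * (a * b)) ≡ N * a * (a * (N * Λ) + b * M * M)
      l2 = solve-∀ ℚ-ring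
      l3 : ∀ t a M V b → t * (a * (M * V) + b * M * M) ≡ t * M * (a * V + b * M)
      l3 = solve-∀ ℚ-ring
      am-gm : ∀ x s → 2ℚ * (N * a) * M * (x * (1ℚ when s)) ≤ N * a * (N * a) * (x * x) + M * M * (1ℚ when s)
      am-gm x true = ≤-by (square-nonneg (N * a * x - M)) (lemma (N * a) M x)
        where
        lemma : ∀ t M x → 2ℚ * t * M * (x * 1ℚ) + (t * x - M) * (t * x - M) ≡ t * t * (x * x) + M * M * 1ℚ + 0ℚ
        lemma = solve-∀ ℚ-ring
      am-gm x false = ≤-by (square-nonneg (N * a * x)) (lemma (N * a) M x)
        where
        lemma : ∀ t M x → 2ℚ * t * M * (x * 0ℚ) + t * x * (t * x) ≡ t * t * (x * x) + M * M * 0ℚ + 0ℚ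
        lemma = solve-∀ ℚ-ring

  input : ∀ {n} → Vec (Fin K) n → Fin n × Fin m → Bool
  input ξ ij = X (lookup ξ (proj₁ ij)) (proj₂ ij)

  listed : ∀ {n} → ℕ → Vec Bool n → (Vec Bool n → Bool) → Bool
  listed {n} ℓ y S = S y ∧ (card S ≡ᵇ 2 ℕ.^ (n ∸ ℓ))

  module _ {n ℓ : ℕ} {η a b : ℚ} (0≤η : 0ℚ ≤ η) (0<a : 0ℚ < a) (0≤b : 0ℚ ≤ b)
           (size : (2 ℕ.^ (n ∸ ℓ)) ×ℚ 1ℚ ≡ 2ℚ ^ℚ n * (a * b)) where

    successMass : Vec (Weights {K}) n → DTree (Fin n × Fin m) (Vec Bool n → Bool) → ℚ
    successMass ws t = expect ws (λ ξ → 1ℚ when listed ℓ (Vec.map Y ξ) (eval t (input ξ)))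

    leafBound : ∀ {ws} → VAll.All NonNeg ws → ∀ S →
      2ℚ * successMass ws (leaf S) ≤ a * ∏ (advantage 0ℚ 0) ws + b * ∏ sum ws
    leafBound {ws} gs S with card S ≡ᵇ 2 ℕ.^ (n ∸ ℓ) in eq
    ... | true = subst (λ z → 2ℚ * z ≤ a * ∏ (advantage 0ℚ 0) ws + b * ∏ sum ws)
      (expect-cong ws (λ ξ → cong (1ℚ when_) (sym (∧-identityʳ (S (Vec.map Y ξ))))))
      (listBound gs 0<a 0≤b S (trans (cong (_×ℚ 1ℚ) (ℕ.≡ᵇ⇒≡ (card S) _ (subst Data.Bool.T (sym eq) tt))) size))
    -- A list of the wrong size is never correct, so the success mass is 0.
    ... | false = begin
      2ℚ * expect ws (λ ξ → 1ℚ when (S (Vec.map Y ξ) ∧ false))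
        ≡⟨ cong (2ℚ *_) (trans (expect-cong ws (λ ξ → trans (cong (1ℚ when_) (∧-zeroʳ (S (Vec.map Y ξ)))) (sym (*-zeroˡ 1ℚ))))
             (trans (expect-* ws 0ℚ (λ _ → 1ℚ)) (*-zeroˡ (expect ws (λ _ → 1ℚ))))) ⟩
      0ℚ  ≤⟨ +-nonneg (*-nonneg (<⇒≤ 0<a) (∏-nonneg {ψ = advantage 0ℚ 0} (advantage-nonneg 0ℚ 0) (λ _ _ → ≤-refl) gs))
               (*-nonneg 0≤b (sum-∏-nonneg gs)) ⟩
      a * ∏ (advantage 0ℚ 0) ws + b * ∏ sum ws ∎
      where open ≤-Reasoning

    0≤1+η : 0ℚ ≤ 1ℚ + η
    0≤1+η = +-nonneg (nonNegative⁻¹ 1ℚ) 0≤η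

    -- Optimality of `minPot` at `suc d` leaves an additive excess `η * sum w`; it becomes the
    -- factor `1ℚ + η` because `sum w` is at most the advantage.
    advantage-query : ∀ d j w → NonNeg w →
      advantage η d (lo j w) + advantage η d (hi j w) ≤ (1ℚ + η) * advantage η (suc d) w
    advantage-query d j w 0≤w = ≤-by
      (+-mono-≤ (minPot-query η d w j) (*-monoˡ 0≤η (sum≤advantage η (suc d) w 0≤w)))
      (trans (lemma (sum (lo j w)) (sum (hi j w)) (minPot η d (lo j w)) (minPot η d (hi j w)) (η * sum w) (η * advantage η (suc d) w))
        (trans (cong (λ s → s + s + η * sum w + η * advantage η (suc d) w) (sym (sum-split (λ k → X k j) w)))
          (lemma′ (sum w) (minPot η (suc d) w) η (η * sum w))))
      where
      lemma : ∀ s t x y e z → s + s - x + (t + t - y) + (e + (x + y) + z) ≡ s + t + (s + t) + e + z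
      lemma = solve-∀ ℚ-ring
      lemma′ : ∀ s m η e → s + s + e + η * (s + s - m) ≡ (1ℚ + η) * (s + s - m) + (m + e)
      lemma′ = solve-∀ ℚ-ring

    advantage₀≤ : ∀ d w → advantage 0ℚ 0 w ≤ advantage η d w
    advantage₀≤ d w = +-monoʳ-≤ (sum w + sum w) (neg-antimono-≤ (minPot≤hw η d w))

    advantage-suc : ∀ d w → advantage η d w ≤ advantage η (suc d) w
    advantage-suc d w = +-monoʳ-≤ (sum w + sum w) (neg-antimono-≤ (minPot-suc η d w))

    -- Induction on the depth budget. Over the two answers to a query the masses `∏ sum` do not grow
    -- in total, while the product of advantages passes to budget `suc d` at a factor `1ℚ + η`.
    -- Leaves follow from `leafBound`, since `advantage 0ℚ 0` is at most `advantage η d`.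
    successBound : ∀ d t {ws} → VAll.All NonNeg ws →
      2ℚ * successMass ws (truncate d (λ _ → false) t) ≤ a * ((1ℚ + η) ^ℚ d * ∏ (advantage η d) ws) + b * ∏ sum ws
    successBound-leaf : ∀ d S {ws} → VAll.All NonNeg ws →
      2ℚ * successMass ws (leaf S) ≤ a * ((1ℚ + η) ^ℚ d * ∏ (advantage η d) ws) + b * ∏ sum ws
    successBound-leaf d S {ws} gs = ≤-trans (leafBound gs S) (+-monoˡ-≤ (b * ∏ sum ws) (*-monoˡ (<⇒≤ 0<a) (begin
      ∏ (advantage 0ℚ 0) ws                    ≤⟨ ∏-mono (advantage-nonneg 0ℚ 0) (λ w _ → advantage₀≤ d w) gs ⟩
      ∏ (advantage η d) ws                     ≡⟨ sym (*-identityˡ _) ⟩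
      1ℚ * ∏ (advantage η d) ws                ≤⟨ *-monoʳ (∏-nonneg {ψ = advantage η d} (advantage-nonneg η d) (λ _ _ → ≤-refl) gs)
                                                    (1≤^ℚ (≤-sum⇐ 0≤η) d) ⟩
      (1ℚ + η) ^ℚ d * ∏ (advantage η d) ws     ∎)))
      where open ≤-Reasoning
    successBound d       (leaf S)      gs = successBound-leaf d S gs
    successBound zero    (query i t u) gs = successBound-leaf 0 (λ _ → false) gs
    successBound (suc d) (query (i , j) t u) {ws} gs = begin
      2ℚ * successMass ws (query (i , j) t′ u′)
        ≡⟨ cong (2ℚ *_) (trans (expect-cong ws pointwise) (expect-if ws i (λ k → X k j) (F u′) (F t′))) ⟩
      2ℚ * (successMass ws₀ t′ + successMass ws₁ u′)
        ≡⟨ *-distribˡ-+ 2ℚ (successMass ws₀ t′) (successMass ws₁ u′) ⟩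
      2ℚ * successMass ws₀ t′ + 2ℚ * successMass ws₁ u′
        ≤⟨ +-mono-≤ (successBound d t (All-updateAt i (λ _ → lo-nonneg j) gs)) (successBound d u (All-updateAt i (λ _ → hi-nonneg j) gs)) ⟩
      a * (E * ∏ A ws₀) + b * ∏ sum ws₀ + (a * (E * ∏ A ws₁) + b * ∏ sum ws₁)
        ≡⟨ l1 a b E (∏ A ws₀) (∏ A ws₁) (∏ sum ws₀) (∏ sum ws₁) ⟩
      a * (E * (∏ A ws₀ + ∏ A ws₁)) + b * (∏ sum ws₀ + ∏ sum ws₁)
        ≤⟨ +-mono-≤ (*-monoˡ (<⇒≤ 0<a) (*-monoˡ (^ℚ-nonneg 0≤1+η d) advantages)) (*-monoˡ 0≤b sums) ⟩
      a * (E * ((1ℚ + η) * ∏ (advantage η (suc d)) ws)) + b * (1ℚ * ∏ sum ws)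
        ≡⟨ l2 a b E (1ℚ + η) (∏ (advantage η (suc d)) ws) (∏ sum ws) ⟩
      a * ((1ℚ + η) * E * ∏ (advantage η (suc d)) ws) + b * ∏ sum ws ∎
      where
      open ≤-Reasoning
      E = (1ℚ + η) ^ℚ d
      A = advantage η d
      t′ = truncate d (λ _ → false) t
      u′ = truncate d (λ _ → false) u
      ws₀ = updateAt ws i (lo j)
      ws₁ = updateAt ws i (hi j)
      F : DTree (Fin n × Fin m) (Vec Bool n → Bool) → Vec (Fin K) n → ℚ
      F t ξ = 1ℚ when listed ℓ (Vec.map Y ξ) (eval t (input ξ))
      pointwise : ∀ ξ → F (query (i , j) t′ u′) ξ ≡ (if X (lookup ξ i) j then F u′ ξ else F t′ ξ)
      pointwise ξ with X (lookup ξ i) j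
      ... | true  = refl
      ... | false = refl
      advantages : ∏ A ws₀ + ∏ A ws₁ ≤ (1ℚ + η) * ∏ (advantage η (suc d)) ws
      advantages = ∏-updateAt-mono (advantage-nonneg η d) (λ w _ → advantage-suc d w) {a = lo j} {b = hi j} (advantage-query d j) gs i 0≤1+η
        (λ w 0≤w → +-nonneg (advantage-nonneg η d (lo j w) (lo-nonneg j 0≤w)) (advantage-nonneg η d (hi j w) (hi-nonneg j 0≤w)))
        (λ _ → lo-nonneg j) (λ _ → hi-nonneg j)
      sums : ∏ sum ws₀ + ∏ sum ws₁ ≤ 1ℚ * ∏ sum ws
      sums = ∏-updateAt-mono {ψ = sum} (λ _ → sum-nonneg) (λ _ _ → ≤-refl) {a = lo j} {b = hi j}
        (λ w _ → ≤-reflexive (trans (sym (sum-split (λ k → X k j) w)) (sym (*-identityˡ (sum w))))) gs i (nonNegative⁻¹ 1ℚ)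
        (λ w 0≤w → +-nonneg (sum-nonneg (lo-nonneg j 0≤w)) (sum-nonneg (hi-nonneg j 0≤w)))
        (λ _ → lo-nonneg j) (λ _ → hi-nonneg j)
      l1 : ∀ a b E x y s t → a * (E * x) + b * s + (a * (E * y) + b * t) ≡ a * (E * (x + y)) + b * (s + t)
      l1 = solve-∀ ℚ-ring
      l2 : ∀ a b E g x s → a * (E * (g * x)) + b * (1ℚ * s) ≡ a * (g * E * x) + b * s
      l2 = solve-∀ ℚ-ring

-- From a list-decoding algorithm to trees on one block

1^ℚ : ∀ n → 1ℚ ^ℚ n ≡ 1ℚ
1^ℚ zero    = refl
1^ℚ (suc n) = trans (*-identityˡ _) (1^ℚ n)

2^-×ℚ : ∀ n → (2 ℕ.^ n) ×ℚ 1ℚ ≡ 2ℚ ^ℚ n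
2^-×ℚ zero    = refl
2^-×ℚ (suc n) = trans (×1-homo-* 2 (2 ℕ.^ n)) (cong (2ℚ *_) (2^-×ℚ n))

sequenceV-just : ∀ {K n} (g : Fin K → Maybe Bool) (Y : Fin K → Bool) → (∀ k → g k ≡ just (Y k)) →
  (ξ : Vec (Fin K) n) → sequenceV (tabulate (λ i → g (lookup ξ i))) ≡ just (Vec.map Y ξ)
sequenceV-just g Y eq []      = refl
sequenceV-just g Y eq (k ∷ ξ) rewrite eq k | sequenceV-just g Y eq ξ = refl

module Reduction {K m : ℕ} {f : PartialFn m} (X : Fin K → Fin m → Bool) (Y : Fin K → Bool)
                 (label : ∀ k → f (X k) ≡ just (Y k)) where
  open Block X Y
  open ListDecoding X Y

  LDTask-correct : ∀ {n ℓ} (ξ : Vec (Fin K) n) S →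
    Task.correct (LDTask n ℓ f) (input ξ) S ≡ listed ℓ (Vec.map Y ξ) S
  LDTask-correct ξ S rewrite sequenceV-just (f ∘ X) Y label ξ = refl

  LDTask-Dom : ∀ {n ℓ} (ξ : Vec (Fin K) n) → Task.Dom (LDTask n ℓ f) (input ξ)
  LDTask-Dom ξ i = subst Is-just (sym (label (lookup ξ i))) (just tt)

  module _ {n ℓ d : ℕ} {γ η : ℚ} (1≤ℓ : 1 ℕ.≤ ℓ) (ℓ≤n : ℓ ℕ.≤ n) (4/5≤γ : (ℤ.+ 4 / 5) ≤ γ)
           (solves : Solves (LDTask n ℓ f) (γ ^ℚ ℓ) d)
           (0≤η : 0ℚ ≤ η) (growth : (1ℚ + η) ^ℚ d ≤ (ℤ.+ 9 / 8) ^ℚ ℓ) where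

    -- (2/3)(3/4) = 1/2 splits the list density `2 ^ (-ℓ)` between the two terms of `successBound`;
    -- (2/3)(9/8) = 3/4 lets `α` absorb the growth, so that both terms become at most `β` times the
    -- total mass. The success rate 4/5 only has to exceed 3/4.
    α β : ℚ
    α = (ℤ.+ 2 / 3) ^ℚ ℓ
    β = (ℤ.+ 3 / 4) ^ℚ ℓ

    0<α : 0ℚ < α
    0<α = ^ℚ-pos (positive⁻¹ (ℤ.+ 2 / 3)) ℓ

    0≤β : 0ℚ ≤ β
    0≤β = ^ℚ-nonneg (nonNegative⁻¹ (ℤ.+ 3 / 4)) ℓ

    listSize : (2 ℕ.^ (n ∸ ℓ)) ×ℚ 1ℚ ≡ 2ℚ ^ℚ n * (α * β)
    listSize = begin
      (2 ℕ.^ (n ∸ ℓ)) ×ℚ 1ℚ                      ≡⟨ 2^-×ℚ (n ∸ ℓ) ⟩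
      2ℚ ^ℚ (n ∸ ℓ)                              ≡⟨ sym (*-identityʳ _) ⟩
      2ℚ ^ℚ (n ∸ ℓ) * 1ℚ                         ≡⟨ cong (2ℚ ^ℚ (n ∸ ℓ) *_) (sym (1^ℚ ℓ)) ⟩
      2ℚ ^ℚ (n ∸ ℓ) * (2ℚ * ½) ^ℚ ℓ              ≡⟨ cong (2ℚ ^ℚ (n ∸ ℓ) *_) (^ℚ-distrib-* 2ℚ ½ ℓ) ⟩
      2ℚ ^ℚ (n ∸ ℓ) * (2ℚ ^ℚ ℓ * ½ ^ℚ ℓ)         ≡⟨ sym (*-assoc (2ℚ ^ℚ (n ∸ ℓ)) (2ℚ ^ℚ ℓ) (½ ^ℚ ℓ)) ⟩
      2ℚ ^ℚ (n ∸ ℓ) * 2ℚ ^ℚ ℓ * ½ ^ℚ ℓ           ≡⟨ cong (_* ½ ^ℚ ℓ) (sym (^ℚ-+ 2ℚ (n ∸ ℓ) ℓ)) ⟩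
      2ℚ ^ℚ (n ∸ ℓ ℕ.+ ℓ) * ½ ^ℚ ℓ               ≡⟨ cong₂ (λ e z → 2ℚ ^ℚ e * z) (ℕ.m∸n+n≡m ℓ≤n) (^ℚ-distrib-* (ℤ.+ 2 / 3) (ℤ.+ 3 / 4) ℓ) ⟩
      2ℚ ^ℚ n * (α * β)                          ∎
      where open ≡-Reasoning

    α-growth : α * (1ℚ + η) ^ℚ d ≤ β
    α-growth = ≤-trans (*-monoˡ (<⇒≤ 0<α) growth) (≤-reflexive (sym (^ℚ-distrib-* (ℤ.+ 2 / 3) (ℤ.+ 9 / 8) ℓ)))

    successMass′ : Vec (Weights {K}) n → DTree (Fin n × Fin m) (Vec Bool n → Bool) → ℚ
    successMass′ = successMass {n} {ℓ} {η} 0≤η 0<α 0≤β listSize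

    -- The easy half of Yao's principle: a bound for every deterministic tree passes to the mixture.
    -- The inputs drawn lie in the domain, where the cost bound makes truncation at depth `d`
    -- invisible.
    expect-successProb : ∀ ws {c} (A : RandAlg (Fin n × Fin m) (Vec Bool n → Bool)) →
      All (λ pt → 0ℚ < proj₁ pt) A → CostAtMost (LDTask n ℓ f) A d →
      (∀ t → successMass′ ws (truncate d (λ _ → false) t) ≤ c) →
      expect ws (λ ξ → successProb (LDTask n ℓ f) A (input ξ)) ≤ totalWeight A * c
    expect-successProb ws {c} [] [] cost le = ≤-reflexive
      (trans (expect-* ws 0ℚ (λ _ → 0ℚ)) (trans (*-zeroˡ (expect ws (λ _ → 0ℚ))) (sym (*-zeroˡ c))))
    expect-successProb ws {c} ((p , t) ∷ A) (0<p ∷ 0<ps) cost le = begin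
      expect ws (λ ξ → (if correct ξ then p else 0ℚ) + successProb (LDTask n ℓ f) A (input ξ))
        ≡⟨ expect-+ ws (λ ξ → if correct ξ then p else 0ℚ) (λ ξ → successProb (LDTask n ℓ f) A (input ξ)) ⟩
      expect ws (λ ξ → if correct ξ then p else 0ℚ) + expect ws (λ ξ → successProb (LDTask n ℓ f) A (input ξ))
        ≡⟨ cong (_+ expect ws (λ ξ → successProb (LDTask n ℓ f) A (input ξ)))
             (trans (expect-cong ws pointwise) (expect-* ws p (λ ξ → 1ℚ when listed ℓ (Vec.map Y ξ) (eval t′ (input ξ))))) ⟩
      p * successMass′ ws t′ + expect ws (λ ξ → successProb (LDTask n ℓ f) A (input ξ))
        ≤⟨ +-mono-≤ (*-monoˡ (<⇒≤ 0<p) (le t)) (expect-successProb ws A 0<ps (λ x dom pt∈ → cost x dom (there pt∈)) le) ⟩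
      p * c + totalWeight A * c
        ≡⟨ sym (*-distribʳ-+ c p (totalWeight A)) ⟩
      (p + totalWeight A) * c ∎
      where
      open ≤-Reasoning
      t′ = truncate d (λ _ → false) t
      correct : Vec (Fin K) n → Bool
      correct ξ = Task.correct (LDTask n ℓ f) (input ξ) (eval t (input ξ))
      pointwise : ∀ ξ → (if correct ξ then p else 0ℚ) ≡ p * (1ℚ when listed ℓ (Vec.map Y ξ) (eval t′ (input ξ)))
      pointwise ξ = trans (cong (λ b → if b then p else 0ℚ) (trans (LDTask-correct {ℓ = ℓ} ξ (eval t (input ξ)))
          (cong (listed ℓ (Vec.map Y ξ)) (sym (eval-truncate d (λ _ → false) t (input ξ) (cost (input ξ) (LDTask-Dom {ℓ = ℓ} ξ) (here refl)))))))
        (scale (listed ℓ (Vec.map Y ξ) (eval t′ (input ξ))))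
        where
        scale : ∀ b → (if b then p else 0ℚ) ≡ p * (1ℚ when b)
        scale true  = sym (*-identityʳ p)
        scale false = sym (*-zeroʳ p)

    -- Otherwise the advantage of `w` is at most `sum w`, and on `n` independent copies of `w` the
    -- success probability is at most `β`, below `γ ^ℚ ℓ`.
    minPot<sum : ∀ {w} → NonNeg w → 0ℚ < sum w → minPot η d w < sum w
    minPot<sum {w} 0≤w 0<s with sum w ≤? minPot η d w
    ... | no ≰ = ≰⇒> ≰
    ... | yes sum≤ = contradiction (<-≤-trans β<γ^ℓ γ^ℓ≤β) (<-irrefl refl)
      where
      open ≤-Reasoning
      ws = replicate n w
      M = ∏ sum ws
      gs : VAll.All NonNeg ws
      gs = All-replicate n 0≤w
      A = proj₁ solves
      positive-weights = proj₁ (proj₁ (proj₂ solves))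
      total≡1 = proj₂ (proj₁ (proj₂ solves))
      cost = proj₁ (proj₂ (proj₂ solves))
      accurate = proj₂ (proj₂ (proj₂ solves))
      β<γ^ℓ : β < γ ^ℚ ℓ
      β<γ^ℓ = ^ℚ-<-monoˡ (positive⁻¹ (ℤ.+ 3 / 4)) (<-≤-trans 3/4<4/5 4/5≤γ) ℓ 1≤ℓ
        where
        3/4<4/5 : (ℤ.+ 3 / 4) < (ℤ.+ 4 / 5)
        3/4<4/5 = toWitness {a? = (ℤ.+ 3 / 4) <? (ℤ.+ 4 / 5)} tt
      advantage≤sum : advantage η d w ≤ sum w
      advantage≤sum = ≤-by sum≤ (lemma (sum w) (minPot η d w))
        where
        lemma : ∀ s m → s + s - m + m ≡ s + s
        lemma = solve-∀ ℚ-ring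
      ∏-advantage≤ : ∏ (advantage η d) ws ≤ M
      ∏-advantage≤ = ∏-mono {Good = λ w → NonNeg w × advantage η d w ≤ sum w}
        (λ w → advantage-nonneg η d w ∘ proj₁) (λ _ → proj₂) (All-replicate n (0≤w , advantage≤sum))
      each : ∀ t → successMass′ ws (truncate d (λ _ → false) t) ≤ β * M
      each t = *-cancel-≤ (positive⁻¹ 2ℚ) (begin
        2ℚ * successMass′ ws (truncate d (λ _ → false) t)
          ≤⟨ successBound {n} {ℓ} {η} 0≤η 0<α 0≤β listSize d t gs ⟩
        α * ((1ℚ + η) ^ℚ d * ∏ (advantage η d) ws) + β * M
          ≡⟨ cong (_+ β * M) (sym (*-assoc α ((1ℚ + η) ^ℚ d) (∏ (advantage η d) ws))) ⟩
        α * (1ℚ + η) ^ℚ d * ∏ (advantage η d) ws + β * M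
          ≤⟨ +-monoˡ-≤ (β * M) (*-mono 0≤β (∏-nonneg {ψ = advantage η d} (advantage-nonneg η d) (λ _ _ → ≤-refl) gs)
               α-growth ∏-advantage≤) ⟩
        β * M + β * M  ≡⟨ lemma (β * M) ⟩
        2ℚ * (β * M)   ∎)
        where
        lemma : ∀ z → z + z ≡ 2ℚ * z
        lemma = solve-∀ ℚ-ring
      γ^ℓ≤β : γ ^ℚ ℓ ≤ β
      γ^ℓ≤β = *-cancel-≤ (∏-pos {φ = sum} {ws = ws} (All-replicate n 0<s)) (begin
        M * γ ^ℚ ℓ                             ≡⟨ *-comm M (γ ^ℚ ℓ) ⟩
        γ ^ℚ ℓ * M                             ≡⟨ cong (γ ^ℚ ℓ *_) (sym (expect-1 ws)) ⟩
        γ ^ℚ ℓ * expect ws (λ _ → 1ℚ)          ≡⟨ sym (expect-* ws (γ ^ℚ ℓ) (λ _ → 1ℚ)) ⟩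
        expect ws (λ _ → γ ^ℚ ℓ * 1ℚ)
          ≤⟨ expect-mono gs (λ ξ → ≤-trans (≤-reflexive (*-identityʳ (γ ^ℚ ℓ))) (accurate (input ξ) (LDTask-Dom {ℓ = ℓ} ξ))) ⟩
        expect ws (λ ξ → successProb (LDTask n ℓ f) A (input ξ))  ≤⟨ expect-successProb ws A positive-weights cost each ⟩
        totalWeight A * (β * M)                ≡⟨ cong (_* (β * M)) total≡1 ⟩
        1ℚ * (β * M)                           ≡⟨ lemma β M ⟩
        M * β                                  ∎)
        where
        lemma : ∀ b M → 1ℚ * (b * M) ≡ M * b
        lemma = solve-∀ ℚ-ring

    -- The tilted weights are balanced, so at a leaf the potential is the full mass and there is no
    -- profit. A profitable tree must begin with a query.
    profitableQuery : ∀ {w} → NonNeg w → 0ℚ < P w → 0ℚ < Q w →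
      ∃ λ j → ∃ λ (t : DTree (Fin m) ⊤) → ∃ λ u →
        pot η (query j t u) (tilt (P w) (Q w) w) < sum (tilt (P w) (Q w) w)
    profitableQuery {w} 0≤w 0<P 0<Q = go (best η d w̃) (minPot<sum 0≤w̃ 0<sum)
      where
      w̃ = tilt (P w) (Q w) w
      0≤w̃ : NonNeg w̃
      0≤w̃ = tilt-nonneg (<⇒≤ 0<P) (<⇒≤ 0<Q) 0≤w
      P≡ : P w̃ ≡ Q w * P w
      P≡ = P-tilt {P w} {Q w} {w̃} {w} (λ _ → refl)
      Q≡ : Q w̃ ≡ Q w * P w
      Q≡ = trans (Q-tilt {P w} {Q w} {w̃} {w} (λ _ → refl)) (*-comm (P w) (Q w))
      sum≡ : sum w̃ ≡ Q w * P w + Q w * P w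
      sum≡ = trans (sum≡P+Q w̃) (cong₂ _+_ P≡ Q≡)
      0<QP : 0ℚ < Q w * P w
      0<QP = *-pos 0<Q 0<P
      0<sum : 0ℚ < sum w̃
      0<sum = subst (0ℚ <_) (sym sum≡) (+-pos 0<QP (<⇒≤ 0<QP))
      go : ∀ T → pot η T w̃ < sum w̃ → ∃ λ j → ∃ λ (t : DTree (Fin m) ⊤) → ∃ λ u → pot η (query j t u) w̃ < sum w̃
      go (query j t u) lt = j , t , u , lt
      go (leaf _)      lt = contradiction (<-≤-trans lt
        (≤-trans (≤-reflexive sum≡) (subst₂ (λ p q → Q w * P w + Q w * P w ≤ h p q) (sym P≡) (sym Q≡) (h-balanced (<⇒≤ 0<QP))))) (<-irrefl refl)

    module _ {δ : ℚ} (0≤δ : 0ℚ ≤ δ) (72δ≡η : (ℤ.+ 72 / 1) * δ ≡ η) where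

      -- With `μ` a twelfth of the mass, 4 · 72 / 12² = 2, so `untilt` turns the price `η` into
      -- `2 δ`. One `δ` pays for the queries of the tree; the other one, charged at the root query,
      -- is the guaranteed progress `δ * sum w`.
      stage : ∀ w → NonNeg w → (ℤ.+ 1 / 12) * sum w < P w → (ℤ.+ 1 / 12) * sum w < Q w →
        ∃ λ (T : DTree (Fin m) ⊤) → pot δ T w + δ * sum w ≤ hw w
      stage w 0≤w μ<P μ<Q = go (profitableQuery 0≤w 0<P 0<Q)
        where
        μ = (ℤ.+ 1 / 12) * sum w
        0≤μ : 0ℚ ≤ μ
        0≤μ = *-nonneg (nonNegative⁻¹ (ℤ.+ 1 / 12)) (sum-nonneg 0≤w)
        0<P : 0ℚ < P w
        0<P = ≤-<-trans 0≤μ μ<P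
        0<Q : 0ℚ < Q w
        0<Q = ≤-<-trans 0≤μ μ<Q
        δ≤δ+δ : δ ≤ δ + δ
        δ≤δ+δ = ≤-sum⇐ 0≤δ
        price : (P w + Q w) * (P w + Q w) * (δ + δ) ≤ 4ℚ * (μ * μ) * η
        price = ≤-reflexive (trans (cong (λ s → s * s * (δ + δ)) (sym (sum≡P+Q w)))
          (trans (lemma (sum w) δ) (cong (4ℚ * (μ * μ) *_) 72δ≡η)))
          where
          lemma : ∀ s δ → s * s * (δ + δ) ≡ 4ℚ * ((ℤ.+ 1 / 12) * s * ((ℤ.+ 1 / 12) * s)) * ((ℤ.+ 72 / 1) * δ)
          lemma = solve-∀ ℚ-ring
        paid : ∀ j (t u : DTree (Fin m) ⊤) → pot δ (query j t u) w + δ * sum w ≤ pot (δ + δ) (query j t u) w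
        paid j t u = ≤-by (+-mono-≤ (pot-monoˡ t (lo-nonneg j 0≤w) δ≤δ+δ) (pot-monoˡ u (hi-nonneg j 0≤w) δ≤δ+δ))
          (lemma δ (sum w) (pot δ t (lo j w) + pot δ u (hi j w)) (pot (δ + δ) t (lo j w) + pot (δ + δ) u (hi j w)))
          where
          lemma : ∀ δ s x y → δ * s + x + δ * s + y ≡ (δ + δ) * s + y + x
          lemma = solve-∀ ℚ-ring
        go : (∃ λ j → ∃ λ (t : DTree (Fin m) ⊤) → ∃ λ u → pot η (query j t u) (tilt (P w) (Q w) w) < sum (tilt (P w) (Q w) w)) →
          ∃ λ (T : DTree (Fin m) ⊤) → pot δ T w + δ * sum w ≤ hw w
        go (j , t , u , profit) = query j t u , ≤-trans (paid j t u)
          (untilt (query j t u) 0≤w 0<P 0<Q 0≤μ 0≤η (<⇒≤ μ<P) (<⇒≤ μ<Q) price (<⇒≤ profit))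

      -- In units of `sum w`, stopping at bias 1/12 costs 12/12 = 1 and the initial potential is at
      -- most 1. A loss of 2 at price 12 per error means error at most 1/6.
      weakLearner : ∀ {q} → q ×ℚ δ ≡ 12ℚ → ∀ w → NonNeg w →
        ∃ λ T → (∀ x → depthOn T x ℕ.≤ q) × err T w ≤ (ℤ.+ 1 / 6) * sum w
      weakLearner {q} qδ≡12 w 0≤w =
        go (iterateStages (nonNegative⁻¹ 12ℚ) 0≤δ (nonNegative⁻¹ (ℤ.+ 1 / 12)) stage q ≤-refl budget w 0≤w)
        where
        open ≤-Reasoning
        budget : 0ℚ + q ×ℚ δ ≡ 12ℚ
        budget = trans (+-identityˡ (q ×ℚ δ)) qδ≡12
        lemma : ∀ s → (12ℚ * (ℤ.+ 1 / 12) + 0ℚ) * s + s + 0ℚ * s ≡ 12ℚ * ((ℤ.+ 1 / 6) * s)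
        lemma = solve-∀ ℚ-ring
        go : (∃ λ T → loss 12ℚ δ T w ≤ (12ℚ * (ℤ.+ 1 / 12) + 0ℚ) * sum w + hw w) →
          ∃ λ T → (∀ x → depthOn T x ℕ.≤ q) × err T w ≤ (ℤ.+ 1 / 6) * sum w
        go (T , T≤) = truncate q true T , depthOn-truncate q true T , *-cancel-≤ (positive⁻¹ 12ℚ) (begin
          12ℚ * err (truncate q true T) w
            ≤⟨ err-truncate (nonNegative⁻¹ 12ℚ) 0≤δ q ≤-refl budget T 0≤w ⟩
          loss 12ℚ δ T w + 0ℚ * sum w
            ≤⟨ +-monoˡ-≤ (0ℚ * sum w) (≤-trans T≤ (+-monoʳ-≤ ((12ℚ * (ℤ.+ 1 / 12) + 0ℚ) * sum w) (hw≤sum 0≤w))) ⟩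
          (12ℚ * (ℤ.+ 1 / 12) + 0ℚ) * sum w + sum w + 0ℚ * sum w
            ≡⟨ lemma (sum w) ⟩
          12ℚ * ((ℤ.+ 1 / 6) * sum w) ∎)

    pot-nonneg : ∀ {O : Set} (T : DTree (Fin m) O) {w} → NonNeg w → 0ℚ ≤ pot η T w
    pot-nonneg (leaf _)      0≤w = h-nonneg (P-nonneg 0≤w) (Q-nonneg 0≤w)
    pot-nonneg (query j t u) 0≤w = +-nonneg (*-nonneg 0≤η (sum-nonneg 0≤w))
      (+-nonneg (pot-nonneg t (lo-nonneg j 0≤w)) (pot-nonneg u (hi-nonneg j 0≤w)))

    -- At price η = 1 a single query already costs more than the potential can drop.
    trivialLearner : η ≡ 1ℚ → ∀ w → NonNeg w →
      ∃ λ T → (∀ x → depthOn T x ℕ.≤ 0) × err T w ≤ (ℤ.+ 1 / 6) * sum w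
    trivialLearner η≡1 w 0≤w = go (0ℚ <? P w) (0ℚ <? Q w)
      where
      w̃ = tilt (P w) (Q w) w
      small : ∀ {x} → x ≤ 0ℚ → x ≤ (ℤ.+ 1 / 6) * sum w
      small x≤0 = ≤-trans x≤0 (*-nonneg (nonNegative⁻¹ (ℤ.+ 1 / 6)) (sum-nonneg 0≤w))
      unaffordable : NonNeg w̃ → ∀ j (t u : DTree (Fin m) ⊤) → sum w̃ ≤ pot η (query j t u) w̃
      unaffordable 0≤w̃ j t u = ≤-trans (≤-reflexive (trans (sym (*-identityˡ (sum w̃))) (cong (_* sum w̃) (sym η≡1))))
        (≤-sum⇐ (+-nonneg (pot-nonneg t (lo-nonneg j 0≤w̃)) (pot-nonneg u (hi-nonneg j 0≤w̃))))
      impossible : 0ℚ < P w → 0ℚ < Q w → ⊥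
      impossible 0<P 0<Q = let (j , t , u , profit) = profitableQuery 0≤w 0<P 0<Q in
        <-irrefl refl (<-≤-trans profit (unaffordable (tilt-nonneg (<⇒≤ 0<P) (<⇒≤ 0<Q) 0≤w) j t u))
      go : Dec (0ℚ < P w) → Dec (0ℚ < Q w) →
        ∃ λ T → (∀ x → depthOn T x ℕ.≤ 0) × err T w ≤ (ℤ.+ 1 / 6) * sum w
      go (no 0≮P)  _         = leaf false , (λ _ → ℕ.z≤n) , small (≮⇒≥ 0≮P)
      go (yes _)   (no 0≮Q)  = leaf true , (λ _ → ℕ.z≤n) , small (≮⇒≥ 0≮Q)
      go (yes 0<P) (yes 0<Q) = ⊥-elim (impossible 0<P 0<Q)

-- Finitely many representative inputs

allBits-complete : ∀ {n} (y : Vec Bool n) → y ∈ allBits n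
allBits-complete []          = here refl
allBits-complete (false ∷ y) = ∈-++⁺ˡ (∈-map⁺ (false ∷_) (allBits-complete y))
allBits-complete {suc n} (true ∷ y) = ∈-++⁺ʳ (map (false ∷_) (allBits n)) (∈-map⁺ (true ∷_) (allBits-complete y))

-- Without function extensionality f may tell pointwise equal inputs apart, so a finite set of
-- representative labelled inputs is extracted classically.
module Representatives {m : ℕ} (f : PartialFn m) where

  Labelled : Set
  Labelled = ∃ λ x → ∃ λ b → f x ≡ just b

  Represents : (Fin m → Bool) → Bool → Labelled → Set
  Represents x b (x′ , b′ , _) = (∀ j → x′ j ≡ x j) × b′ ≡ b

  Covers : List Labelled → Vec Bool m × Bool → Set
  Covers D (v , b) = ∀ x → (∀ j → lookup v j ≡ x j) → f x ≡ just b → Any (Represents x b) D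

  collect : ∀ vbs → ¬ ¬ (∃ λ D → All (Covers D) vbs)
  collect []              k = k ([] , [])
  collect ((v , b) ∷ vbs) k = collect vbs λ (D , covers) → ¬¬-excluded-middle {A = ∃ λ x → (∀ j → lookup v j ≡ x j) × f x ≡ just b} λ where
    (yes (x₀ , v≗x₀ , fx₀≡)) → k ((x₀ , b , fx₀≡) ∷ D ,
      (λ x v≗x _ → here ((λ j → trans (sym (v≗x₀ j)) (v≗x j)) , refl)) ∷
      All.map (λ c x v≗x fx≡ → there (c x v≗x fx≡)) covers)
    (no ¬x₀) → k (D , (λ x v≗x fx≡ → contradiction (x , v≗x , fx≡) ¬x₀) ∷ covers)

  representatives : ¬ ¬ (∃ λ D → ∀ x b → f x ≡ just b → Any (Represents x b) D)
  representatives k = collect (cartesianProduct (allBits m) (true ∷ false ∷ [])) λ (D , covers) →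
    k (D , λ x b → All.lookup covers (∈-cartesianProduct⁺ (allBits-complete (tabulate x)) (∈-Bool b)) x (lookup∘tabulate x))
    where
    ∈-Bool : ∀ b → b ∈ (true ∷ false ∷ [])
    ∈-Bool true  = here refl
    ∈-Bool false = there (here refl)

-- Choice of parameters and the final bound

×1≡ℕ→ℚ : ∀ n → n ×ℚ 1ℚ ≡ ℕ→ℚ n
×1≡ℕ→ℚ zero    = refl
×1≡ℕ→ℚ (suc n) = trans (cong (1ℚ +_) (trans (×1≡ℕ→ℚ n) (↥p/↧p≡p (mkℚ (ℤ.+ n) 0 coprime))))
  (/-cong (cong (λ z → ℤ.+ 1 ℤ.+ z) (ℤ.*-identityʳ (ℤ.+ n))) refl)
  where
  coprime = Coprime.sym (Coprime.1-coprimeTo n)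

ℕ→ℚ-* : ∀ m n → ℕ→ℚ (m ℕ.* n) ≡ ℕ→ℚ m * ℕ→ℚ n
ℕ→ℚ-* m n = trans (sym (×1≡ℕ→ℚ (m ℕ.* n))) (trans (×1-homo-* m n) (cong₂ _*_ (×1≡ℕ→ℚ m) (×1≡ℕ→ℚ n)))

ℕ→ℚ-mono : ∀ {m n} → m ℕ.≤ n → ℕ→ℚ m ≤ ℕ→ℚ n
ℕ→ℚ-mono {m} {n} m≤n = subst₂ _≤_ (×1≡ℕ→ℚ m) (×1≡ℕ→ℚ n) (×ℚ-monoˡ (nonNegative⁻¹ 1ℚ) m≤n)

-- An upper bound for compound growth, by induction from `(1 + η) (1 - η - x) = 1 - x - η (η + x)`.
compound : ∀ {η} → 0ℚ ≤ η → ∀ k → (1ℚ + η) ^ℚ k * (1ℚ - k ×ℚ η) ≤ 1ℚ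
compound {η} 0≤η zero    = ≤-refl
compound {η} 0≤η (suc k) = ≤-trans
  (≤-by (*-nonneg (^ℚ-nonneg 0≤1+η k) (*-nonneg 0≤η (×ℚ-nonneg (suc k) 0≤η))) (lemma η ((1ℚ + η) ^ℚ k) (k ×ℚ η)))
  (compound 0≤η k)
  where
  0≤1+η : 0ℚ ≤ 1ℚ + η
  0≤1+η = +-nonneg (nonNegative⁻¹ 1ℚ) 0≤η
  lemma : ∀ η g x → (1ℚ + η) * g * (1ℚ - (η + x)) + g * (η * (η + x)) ≡ g * (1ℚ - x) + 0ℚ
  lemma = solve-∀ ℚ-ring

module _ {m n ℓ d : ℕ} {f : PartialFn m} {γ : ℚ} (1≤ℓ : 1 ℕ.≤ ℓ) (ℓ≤n : ℓ ℕ.≤ n) (4/5≤γ : (ℤ.+ 4 / 5) ≤ γ)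
         (solves : Solves (LDTask n ℓ f) (γ ^ℚ ℓ) d) where

  open Representatives f

  module _ (D : List Labelled) (cover : ∀ x b → f x ≡ just b → Any (Represents x b) D) where

    X : Fin (length D) → Fin m → Bool
    X k = proj₁ (List.lookup D k)

    Y : Fin (length D) → Bool
    Y k = proj₁ (proj₂ (List.lookup D k))

    label : ∀ k → f (X k) ≡ just (Y k)
    label k = proj₂ (proj₂ (List.lookup D k))

    cover′ : ∀ x b → f x ≡ just b → ∃ λ k → (∀ j → X k j ≡ x j) × Y k ≡ b
    cover′ x b fx≡ = Any.index any , lookup-index any
      where any = cover x b fx≡

    -- Since `2 ≤ (9/8) ^ 6`, the price `η = 1` meets the growth condition. The case is separate
    -- because `manyQueries` rounds `d / ℓ` up to at least 1, which is too coarse when `d` is small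
    -- against `ℓ`.
    fewQueries : d ℕ.* 6 ℕ.≤ ℓ → Solves (fTask f) twoThirds 0
    fewQueries 6d≤ℓ = Boosting.boost X Y
      (Reduction.trivialLearner {f = f} X Y label {γ = γ} 1≤ℓ ℓ≤n 4/5≤γ solves (nonNegative⁻¹ 1ℚ) growth refl) cover′
      where
      open ≤-Reasoning
      growth : (1ℚ + 1ℚ) ^ℚ d ≤ (ℤ.+ 9 / 8) ^ℚ ℓ
      growth = begin
        (1ℚ + 1ℚ) ^ℚ d                ≤⟨ ^ℚ-monoˡ {1ℚ + 1ℚ} {(ℤ.+ 9 / 8) ^ℚ 6} (nonNegative⁻¹ (1ℚ + 1ℚ)) (≤ᵇ⇒≤ _) d ⟩
        ((ℤ.+ 9 / 8) ^ℚ 6) ^ℚ d       ≡⟨ sym (^ℚ-* (ℤ.+ 9 / 8) d 6) ⟩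
        (ℤ.+ 9 / 8) ^ℚ (d ℕ.* 6)      ≤⟨ ^ℚ-monoʳ {ℤ.+ 9 / 8} (≤ᵇ⇒≤ _) 6d≤ℓ ⟩
        (ℤ.+ 9 / 8) ^ℚ ℓ              ∎

    manyQueries : ∀ k q → 1 ℕ.≤ k → d ℕ.≤ ℓ ℕ.* k → ℕ→ℚ q ≡ ℕ→ℚ k * ℕ→ℚ 7776 → Solves (fTask f) twoThirds q
    manyQueries k q 1≤k d≤ℓk q≡ = Boosting.boost X Y
      (Reduction.weakLearner {f = f} X Y label {γ = γ} 1≤ℓ ℓ≤n 4/5≤γ solves 0≤η growth 0≤δ refl budget) cover′
      where
      open ≤-Reasoning
      0<k : 0ℚ < k ×ℚ 1ℚ
      0<k = <-≤-trans (positive⁻¹ (1 ×ℚ 1ℚ)) (×ℚ-monoˡ (nonNegative⁻¹ 1ℚ) 1≤k)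
      -- 648 = 9 · 72 gives `k ×ℚ η` the value 1/9, whence growth at most 9/8 over `k` queries. The
      -- budget 12 then takes 12 · 648 = 7776 queries per unit of `k`.
      δ = (ℤ.+ 1 / 648) * inv (k ×ℚ 1ℚ)
      η = (ℤ.+ 72 / 1) * δ
      0≤δ : 0ℚ ≤ δ
      0≤δ = *-nonneg (nonNegative⁻¹ (ℤ.+ 1 / 648)) (<⇒≤ (inv-pos 0<k))
      0≤η : 0ℚ ≤ η
      0≤η = *-nonneg (nonNegative⁻¹ (ℤ.+ 72 / 1)) 0≤δ
      kη≡1/9 : k ×ℚ η ≡ ℤ.+ 1 / 9
      kη≡1/9 = trans (×ℚ-* k η) (trans (lemma (k ×ℚ 1ℚ) (inv (k ×ℚ 1ℚ))) (trans (cong ((ℤ.+ 1 / 9) *_) (*-inv 0<k)) (*-identityʳ _)))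
        where
        lemma : ∀ k i → k * ((ℤ.+ 72 / 1) * ((ℤ.+ 1 / 648) * i)) ≡ (ℤ.+ 1 / 9) * (k * i)
        lemma = solve-∀ ℚ-ring
      budget : q ×ℚ δ ≡ 12ℚ
      budget = trans (×ℚ-* q δ) (trans (cong (_* δ) (trans (×1≡ℕ→ℚ q) (trans q≡ (cong (_* ℕ→ℚ 7776) (sym (×1≡ℕ→ℚ k))))))
        (trans (lemma (k ×ℚ 1ℚ) (inv (k ×ℚ 1ℚ))) (trans (cong (12ℚ *_) (*-inv 0<k)) (*-identityʳ _))))
        where
        lemma : ∀ k i → k * ℕ→ℚ 7776 * ((ℤ.+ 1 / 648) * i) ≡ 12ℚ * (k * i)
        lemma = solve-∀ ℚ-ring
      growth₁ : (1ℚ + η) ^ℚ k ≤ ℤ.+ 9 / 8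
      growth₁ = *-cancel-≤ (positive⁻¹ (ℤ.+ 8 / 9)) (begin
        (ℤ.+ 8 / 9) * (1ℚ + η) ^ℚ k          ≡⟨ *-comm (ℤ.+ 8 / 9) ((1ℚ + η) ^ℚ k) ⟩
        (1ℚ + η) ^ℚ k * (1ℚ - (ℤ.+ 1 / 9))   ≡⟨ cong (λ z → (1ℚ + η) ^ℚ k * (1ℚ - z)) (sym kη≡1/9) ⟩
        (1ℚ + η) ^ℚ k * (1ℚ - k ×ℚ η)        ≤⟨ compound 0≤η k ⟩
        (ℤ.+ 8 / 9) * (ℤ.+ 9 / 8)            ∎)
      growth : (1ℚ + η) ^ℚ d ≤ (ℤ.+ 9 / 8) ^ℚ ℓ
      growth = begin
        (1ℚ + η) ^ℚ d              ≤⟨ ^ℚ-monoʳ (≤-sum⇐ 0≤η) d≤ℓk ⟩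
        (1ℚ + η) ^ℚ (ℓ ℕ.* k)      ≡⟨ ^ℚ-* (1ℚ + η) ℓ k ⟩
        ((1ℚ + η) ^ℚ k) ^ℚ ℓ       ≤⟨ ^ℚ-monoˡ (^ℚ-nonneg (+-nonneg (nonNegative⁻¹ 1ℚ) 0≤η) k) growth₁ ℓ ⟩
        (ℤ.+ 9 / 8) ^ℚ ℓ           ∎

    -- Rounding up adds at most one `ℓ`, that is at most `6 d`, to `d`.
    ratio : .⦃ ℕ.NonZero ℓ ⦄ → ℓ ℕ.≤ d ℕ.* 6 → ∃ λ k → 1 ℕ.≤ k × d ℕ.≤ ℓ ℕ.* k × ℓ ℕ.* k ℕ.≤ d ℕ.* 7
    ratio ℓ≤6d = suc (d ℕ./ ℓ) , ℕ.s≤s ℕ.z≤n , lower , upper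
      where
      open ℕ.≤-Reasoning
      ℓk≡ : ℓ ℕ.* suc (d ℕ./ ℓ) ≡ ℓ ℕ.+ d ℕ./ ℓ ℕ.* ℓ
      ℓk≡ = ℕ.*-comm ℓ (suc (d ℕ./ ℓ))
      lower : d ℕ.≤ ℓ ℕ.* suc (d ℕ./ ℓ)
      lower = begin
        d                               ≡⟨ m≡m%n+[m/n]*n d ℓ ⟩
        d ℕ.% ℓ ℕ.+ d ℕ./ ℓ ℕ.* ℓ       ≤⟨ ℕ.+-monoˡ-≤ (d ℕ./ ℓ ℕ.* ℓ) (ℕ.<⇒≤ (m%n<n d ℓ)) ⟩
        ℓ ℕ.+ d ℕ./ ℓ ℕ.* ℓ             ≡⟨ sym ℓk≡ ⟩
        ℓ ℕ.* suc (d ℕ./ ℓ)             ∎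
      upper : ℓ ℕ.* suc (d ℕ./ ℓ) ℕ.≤ d ℕ.* 7
      upper = begin
        ℓ ℕ.* suc (d ℕ./ ℓ)             ≡⟨ ℓk≡ ⟩
        ℓ ℕ.+ d ℕ./ ℓ ℕ.* ℓ             ≤⟨ ℕ.+-mono-≤ ℓ≤6d (m/n*n≤m d ℓ) ⟩
        d ℕ.* 6 ℕ.+ d                   ≡⟨ ℕ.+-comm (d ℕ.* 6) d ⟩
        d ℕ.+ d ℕ.* 6                   ≡⟨ sym (ℕ.*-suc d 6) ⟩
        d ℕ.* 7                         ∎

    ℓr≤ : ∀ r → RLowerBound f r → ℓ ℕ.* r ℕ.≤ d ℕ.* 54432
    ℓr≤ r lower = byCases (d ℕ.* 6 ℕ.≤? ℓ)
      where
      open ℕ.≤-Reasoning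
      many : (∃ λ k → 1 ℕ.≤ k × d ℕ.≤ ℓ ℕ.* k × ℓ ℕ.* k ℕ.≤ d ℕ.* 7) → ℓ ℕ.* r ℕ.≤ d ℕ.* 54432
      many (k , 1≤k , d≤ℓk , ℓk≤7d) = begin
        ℓ ℕ.* r                  ≤⟨ ℕ.*-monoʳ-≤ ℓ (lower (k ℕ.* 7776) (manyQueries k (k ℕ.* 7776) 1≤k d≤ℓk q≡)) ⟩
        ℓ ℕ.* (k ℕ.* 7776)       ≡⟨ sym (ℕ.*-assoc ℓ k 7776) ⟩
        ℓ ℕ.* k ℕ.* 7776         ≤⟨ ℕ.*-monoˡ-≤ 7776 ℓk≤7d ⟩
        d ℕ.* 7 ℕ.* 7776         ≡⟨ ℕ.*-assoc d 7 7776 ⟩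
        d ℕ.* 54432              ∎
        where
        q≡ : ℕ→ℚ (k ℕ.* 7776) ≡ ℕ→ℚ k * ℕ→ℚ 7776
        q≡ = ℕ→ℚ-* k 7776
      byCases : Dec (d ℕ.* 6 ℕ.≤ ℓ) → ℓ ℕ.* r ℕ.≤ d ℕ.* 54432
      byCases (yes 6d≤ℓ) = ℕ.≤-trans (ℕ.≤-reflexive (trans (cong (ℓ ℕ.*_) (ℕ.n≤0⇒n≡0 (lower 0 (fewQueries 6d≤ℓ)))) (ℕ.*-zeroʳ ℓ))) ℕ.z≤n
      byCases (no 6d≰ℓ)  = many (ratio ⦃ ℕ.>-nonZero 1≤ℓ ⦄ (ℕ.<⇒≤ (ℕ.≰⇒> 6d≰ℓ)))

  lowerBound : ∀ r → RLowerBound f r → (ℤ.+ 1 / 54432) * ℕ→ℚ ℓ * ℕ→ℚ r ≤ ℕ→ℚ d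
  lowerBound r lower = begin
    (ℤ.+ 1 / 54432) * ℕ→ℚ ℓ * ℕ→ℚ r      ≡⟨ *-assoc (ℤ.+ 1 / 54432) (ℕ→ℚ ℓ) (ℕ→ℚ r) ⟩
    (ℤ.+ 1 / 54432) * (ℕ→ℚ ℓ * ℕ→ℚ r)    ≡⟨ cong ((ℤ.+ 1 / 54432) *_) (sym (ℕ→ℚ-* ℓ r)) ⟩
    (ℤ.+ 1 / 54432) * ℕ→ℚ (ℓ ℕ.* r)      ≤⟨ *-monoˡ (nonNegative⁻¹ (ℤ.+ 1 / 54432)) (ℕ→ℚ-mono bound) ⟩
    (ℤ.+ 1 / 54432) * ℕ→ℚ (d ℕ.* 54432)  ≡⟨ cong ((ℤ.+ 1 / 54432) *_) (ℕ→ℚ-* d 54432) ⟩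
    (ℤ.+ 1 / 54432) * (ℕ→ℚ d * ℕ→ℚ 54432)  ≡⟨ lemma (ℕ→ℚ d) ⟩
    ℕ→ℚ d                                ∎
    where
    open ≤-Reasoning
    bound : ℓ ℕ.* r ℕ.≤ d ℕ.* 54432
    -- The goal is a decidable inequality, so representatives known to exist only up to double
    -- negation suffice.
    bound = decidable-stable (ℓ ℕ.* r ℕ.≤? d ℕ.* 54432)
      λ ≰ → representatives λ (D , cover) → ≰ (ℓr≤ D cover r lower)
    lemma : ∀ z → (ℤ.+ 1 / 54432) * (z * ℕ→ℚ 54432) ≡ z
    lemma = solve-∀ ℚ-ring

theorem1p2 : Σ ℚ λ c → (½ < c × c < 1ℚ) × Σ ℚ λ κ → 0ℚ < κ ×
    ((m : ℕ) (f : PartialFn m) (n ℓ : ℕ) → 1 ℕ.≤ n → 1 ℕ.≤ ℓ → ℓ ℕ.≤ n →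
    (γ : ℚ) → c ≤ γ → γ < 1ℚ →
    (d : ℕ) → Solves (LDTask n ℓ f) (γ ^ℚ ℓ) d →
    (r : ℕ) → RLowerBound f r →
    κ * ℕ→ℚ ℓ * ℕ→ℚ r ≤ ℕ→ℚ d)
theorem1p2 = (ℤ.+ 4 / 5) , (toWitness {a? = ½ <? (ℤ.+ 4 / 5)} tt , toWitness {a? = (ℤ.+ 4 / 5) <? 1ℚ} tt) ,
  (ℤ.+ 1 / 54432) , positive⁻¹ (ℤ.+ 1 / 54432) ,
  λ m f n ℓ _ 1≤ℓ ℓ≤n γ c≤γ _ d solves → lowerBound {γ = γ} 1≤ℓ ℓ≤n c≤γ solves
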